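{- Let $q$ be a positive integer and let $\pi$ be a permutation of the set $\{\lceil q/2\rceil,\lceil q/2\rceil+1,\ldots,q\}$. Then there is a well-covered graph $G$ with $\alpha(G)=q$ such that \[ i_{\pi(\lceil q/2\rceil)}(G)<i_{\pi(\lceil q/2\rceil+1)}(G)<\cdots<i_{\pi(q)}(G). \]
   Context: All graphs are finite and simple. For a graph $G$, $i_k(G)$ denotes the number of independent sets of cardinality $k$ in $G$, and $\alpha(G)$ is the independence number (the largest $k$ with $i_k(G)>0$). A graph is well-covered if every maximal independent set has the same cardinality. -}

module Defs where

open import Data.Nat using (ℕ; zero; suc; _+_; _∸_; _/_; _<_; _≤_)
open import Data.Bool using (Bool; true; false; T; not; _∧_)
open import Data.Fin using (Fin; toℕ)
open import Data.Fin.Subset using (Subset; _∈_; _⊆_; ∣_∣; outside; inside)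
open import Data.Vec using (Vec; []; _∷_)
open import Data.List using (List; []; _∷_; map; _++_; length; filter)
open import Data.Product using (Σ; _×_; _,_; ∃)
open import Relation.Nullary using (¬_; Dec)
open import Relation.Binary.PropositionalEquality using (_≡_)
open import Function.Bundles using (_↔_)

record Graph (n : ℕ) : Set where
  field
    adj     : Fin n → Fin n → Bool
    symm    : ∀ u v → adj u v ≡ adj v u
    irrefl  : ∀ v → adj v v ≡ false

open Graph public

Independent : ∀ {n} → Graph n → Subset n → Set
Independent G S = ∀ u v → u ∈ S → v ∈ S → adj G u v ≡ false

allFins : (n : ℕ) → List (Fin n)
allFins zero = []
allFins (suc n) = Fin.zero ∷ map Fin.suc (allFins n)

memb : ∀ {n} → Subset n → Fin n → Bool
memb (b ∷ _) Fin.zero = b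
memb (_ ∷ S) (Fin.suc i) = memb S i

allL : ∀ {A : Set} → (A → Bool) → List A → Bool
allL p [] = true
allL p (x ∷ xs) = p x ∧ allL p xs

independent? : ∀ {n} → Graph n → Subset n → Bool
independent? {n} G S =
  allL (λ u → allL (λ v → not (memb S u ∧ memb S v ∧ adj G u v)) (allFins n)) (allFins n)

allSubsets : (n : ℕ) → List (Subset n)
allSubsets zero = [] ∷ []
allSubsets (suc n) = map (outside ∷_) (allSubsets n) ++ map (inside ∷_) (allSubsets n)

sizeIs : ∀ {n} → ℕ → Subset n → Bool
sizeIs k S = eqℕ ∣ S ∣ k
  where
  eqℕ : ℕ → ℕ → Bool
  eqℕ zero zero = true
  eqℕ (suc a) (suc b) = eqℕ a b
  eqℕ _ _ = false

count : ∀ {A : Set} → (A → Bool) → List A → ℕ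
count p [] = 0
count p (x ∷ xs) with p x
... | true  = suc (count p xs)
... | false = count p xs

i : ∀ {n} → ℕ → Graph n → ℕ
i {n} k G = count (λ S → independent? G S ∧ sizeIs k S) (allSubsets n)

MaximalIndependent : ∀ {n} → Graph n → Subset n → Set
MaximalIndependent G S =
  Independent G S × (∀ T → Independent G T → S ⊆ T → T ⊆ S)

WellCovered : ∀ {n} → Graph n → Set
WellCovered G = ∀ S T → MaximalIndependent G S → MaximalIndependent G T → ∣ S ∣ ≡ ∣ T ∣

IndependenceNumber : ∀ {n} → Graph n → ℕ → Set
IndependenceNumber G q =
  (Σ _ λ S → Independent G S × ∣ S ∣ ≡ q) × (∀ S → Independent G S → ∣ S ∣ ≤ q)

ceilHalf : ℕ → ℕ
ceilHalf q = q ∸ (q / 2)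

{-# OPTIONS --safe #-}
-- For k < q and any L there are well-covered graphs with α = q, obtained by letting the vertices of a
-- maximal independent set carry partial information about a hidden word, in which any k+1 vertices of
-- an independent set determine the maximal one and any k of them leave many possibilities open.
-- Counting extensions gives i_j = (q choose j) E with E = i_q for j > k, and i_j ≤ E / L for
-- 0 < j ≤ k.  Joins add these sequences, so up to a small error i_j / (q choose j) can be any
-- nondecreasing sequence.  Since the binomials strictly decrease from ⌈q/2⌉ on, one can take
-- i_j ≈ const · (M + r_j) with M large and r the prescribed ranking.
module Submission where

open import Defs
open import Data.Nat using (ℕ; _+_; _∸_; _<_; NonZero)
open import Data.Fin using (Fin; toℕ)
open import Data.Product using (Σ; _×_)
open import Function.Bundles using (_↔_; Inverse; mk⇔)
open import Data.Nat.Base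
open import Data.Nat.DivMod using (m/n*n≤m; m/n<m)
open import Data.Nat.Properties
open import Data.Nat.Solver using (module +-*-Solver)
open import Algebra.Properties.CommutativeSemigroup +-commutativeSemigroup using (interchange)
open import Algebra.Properties.Semiring.Sum +-*-semiring
  using (sum; sum-syntax; sum-cong-≗; ∑-comm; ∑-distrib-+; *-distribˡ-sum; *-distribʳ-sum)
open import Data.Bool.Base using (Bool; true; false; not; _∧_; if_then_else_)
open import Data.Fin.Base
  using (zero; suc; _↑ˡ_; _↑ʳ_; splitAt; combine; remQuot; finToFun; funToFin; fromℕ<)
open import Data.Fin.Properties
  using (any?; all?; toℕ<n; toℕ-fromℕ<; splitAt-↑ˡ; splitAt-↑ʳ; splitAt⁻¹-↑ˡ; splitAt⁻¹-↑ʳ;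
         remQuot-combine; combine-remQuot; finToFun-funToFin; funToFin-finToFin)
  renaming (_≟_ to _≟ᶠ_; suc-injective to sucᶠ-injective)
open import Data.Fin.Subset
  using (Subset; inside; outside; _∈_; _∉_; _⊆_; ∣_∣; Empty; Nonempty; ⊥)
open import Data.Fin.Subset.Properties using (_∈?_; nonempty?; drop-there; ∉⊥; ∣⊥∣≡0)
open import Data.List.Base as List using (List; []; _∷_)
open import Data.Product.Base using (∃; _,_; proj₁; proj₂)
open import Data.Sum.Base using (_⊎_; inj₁; inj₂; [_,_]′; map₂)
open import Data.Vec.Base as Vec using ([]; _∷_; _[_]≔_; here; there; _++_)
open import Data.Vec.Properties using ([]≔-updates; []≔-minimal)
open import Function.Base using (_∘_)
open import Relation.Binary.PropositionalEquality hiding ([_])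
open import Relation.Nullary
open import Relation.Nullary.Decidable using (does-⇔; decidable-stable; dec-true; dec-false)

-- The constants must be chosen in an order that is not circular. The targets
-- `(M + r_j) · j! (q - j)!`, and their consecutive differences, which serve as multiplicities in
-- the join, depend only on `q` and the ranking. The precision `L` is taken from the sum of these
-- multiplicities, the alphabet size of the hidden words from `L`, and `E` is known only after the
-- graphs are built, with a different value for each `k`. Taking copies multiplies `i_j` and `E`
-- alike and leaves `L` unchanged, so all `E` can afterwards be made equal. Writing `(q choose j)`
-- as `q! / (j! (q - j)!)` keeps every estimate in `ℕ`. The final sequence satisfies `E q! (M + r_j)
-- ≤ i_j < E q! (M + r_j + 1)`: the total error stays below one unit `E q!`, so ranks that differ by
-- one are already separated. Sizes start at 1 throughout, since joins do not add the number of
-- empty sets.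

private
  variable
    A B C : Set
    m n q : ℕ

-- Indicator functions and finite sums

𝟙 : Dec A → ℕ
𝟙 a? = if does a? then 1 else 0

𝟙-yes : (a? : Dec A) → A → 𝟙 a? ≡ 1
𝟙-yes (yes _) _ = refl
𝟙-yes (no ¬a) a = contradiction a ¬a

𝟙-no : (a? : Dec A) → ¬ A → 𝟙 a? ≡ 0
𝟙-no (yes a) ¬a = contradiction a ¬a
𝟙-no (no _)  _  = refl

𝟙-cong : (a? : Dec A) (b? : Dec B) → (A → B) → (B → A) → 𝟙 a? ≡ 𝟙 b?
𝟙-cong (yes a) b? f g = sym (𝟙-yes b? (f a))
𝟙-cong (no ¬a) b? f g = sym (𝟙-no b? (¬a ∘ g))

𝟙-× : (a? : Dec A) (b? : Dec B) → 𝟙 (a? ×-dec b?) ≡ 𝟙 a? * 𝟙 b?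
𝟙-× (yes _) (yes _) = refl
𝟙-× (yes _) (no _)  = refl
𝟙-× (no _)  b?      = refl

𝟙-*-cong : (a? : Dec A) {x y : ℕ} → (A → x ≡ y) → 𝟙 a? * x ≡ 𝟙 a? * y
𝟙-*-cong (yes a) x≡y = cong (1 *_) (x≡y a)
𝟙-*-cong (no _)  _   = refl

𝟙-*-mono : (a? : Dec A) {x y : ℕ} → (A → x ≤ y) → 𝟙 a? * x ≤ 𝟙 a? * y
𝟙-*-mono (yes a) x≤y = *-monoʳ-≤ 1 (x≤y a)
𝟙-*-mono (no _)  _   = z≤n

𝟙-⊎ : (c? : Dec C) (a? : Dec A) (b? : Dec B) → (C → A ⊎ B) → (A ⊎ B → C) → ¬ (A × B) →
      𝟙 c? ≡ 𝟙 a? + 𝟙 b?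
𝟙-⊎ c? (yes a) (yes b) f g ¬ab = contradiction (a , b) ¬ab
𝟙-⊎ c? (yes a) (no _)  f g ¬ab = 𝟙-yes c? (g (inj₁ a))
𝟙-⊎ c? (no _)  (yes b) f g ¬ab = 𝟙-yes c? (g (inj₂ b))
𝟙-⊎ c? (no ¬a) (no ¬b) f g ¬ab =
  𝟙-no c? ([ ¬a , ¬b ]′ ∘ f)

sum-mono : {f g : Fin n → ℕ} → (∀ v → f v ≤ g v) → sum f ≤ sum g
sum-mono {zero}  f≤g = z≤n
sum-mono {suc n} f≤g = +-mono-≤ (f≤g zero) (sum-mono (f≤g ∘ suc))

sum-zero : {f : Fin n → ℕ} → (∀ v → f v ≡ 0) → sum f ≡ 0
sum-zero {zero}  f≡0 = refl
sum-zero {suc n} f≡0 = cong₂ _+_ (f≡0 zero) (sum-zero (f≡0 ∘ suc))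

sum-one : sum {n} (λ _ → 1) ≡ n
sum-one {zero}  = refl
sum-one {suc n} = cong suc sum-one

sum-single : (f : Fin n → ℕ) (w : Fin n) → (∀ v → v ≢ w → f v ≡ 0) → sum f ≡ f w
sum-single f zero    z =
  trans (cong (f zero +_) (sum-zero λ v → z (suc v) λ ())) (+-identityʳ _)
sum-single f (suc w) z =
  cong₂ _+_ (z zero λ ()) (sum-single (f ∘ suc) w λ v v≢w → z (suc v) (v≢w ∘ sucᶠ-injective))

∑ˢ : (Subset n → ℕ) → ℕ
∑ˢ {zero}  f = f []
∑ˢ {suc n} f = ∑ˢ (f ∘ (outside ∷_)) + ∑ˢ (f ∘ (inside ∷_))

∑ˢ-cong : {f g : Subset n → ℕ} → (∀ S → f S ≡ g S) → ∑ˢ f ≡ ∑ˢ g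
∑ˢ-cong {zero}  f≡g = f≡g []
∑ˢ-cong {suc n} f≡g = cong₂ _+_ (∑ˢ-cong (f≡g ∘ (outside ∷_))) (∑ˢ-cong (f≡g ∘ (inside ∷_)))

∑ˢ-mono : {f g : Subset n → ℕ} → (∀ S → f S ≤ g S) → ∑ˢ f ≤ ∑ˢ g
∑ˢ-mono {zero}  f≤g = f≤g []
∑ˢ-mono {suc n} f≤g = +-mono-≤ (∑ˢ-mono (f≤g ∘ (outside ∷_))) (∑ˢ-mono (f≤g ∘ (inside ∷_)))

∑ˢ-distrib-+ : (f g : Subset n → ℕ) → ∑ˢ (λ S → f S + g S) ≡ ∑ˢ f + ∑ˢ g
∑ˢ-distrib-+ {zero}  f g = refl
∑ˢ-distrib-+ {suc n} f g = begin
  ∑ˢ (λ S → f (outside ∷ S) + g (outside ∷ S)) + ∑ˢ (λ S → f (inside ∷ S) + g (inside ∷ S))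
    ≡⟨ cong₂ _+_ (∑ˢ-distrib-+ (f ∘ (outside ∷_)) (g ∘ (outside ∷_)))
                 (∑ˢ-distrib-+ (f ∘ (inside ∷_)) (g ∘ (inside ∷_))) ⟩
  (∑ˢ (f ∘ (outside ∷_)) + ∑ˢ (g ∘ (outside ∷_))) + (∑ˢ (f ∘ (inside ∷_)) + ∑ˢ (g ∘ (inside ∷_)))
    ≡⟨ interchange (∑ˢ (f ∘ (outside ∷_))) _ _ _ ⟩
  ∑ˢ f + ∑ˢ g ∎
  where open ≡-Reasoning

∑ˢ-*ʳ : (f : Subset n → ℕ) (d : ℕ) → ∑ˢ (λ S → f S * d) ≡ ∑ˢ f * d
∑ˢ-*ʳ {zero}  f d = refl
∑ˢ-*ʳ {suc n} f d =
  trans (cong₂ _+_ (∑ˢ-*ʳ (f ∘ (outside ∷_)) d) (∑ˢ-*ʳ (f ∘ (inside ∷_)) d))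
        (sym (*-distribʳ-+ d (∑ˢ (f ∘ (outside ∷_))) _))

∑ˢ-*ˡ : (d : ℕ) (f : Subset n → ℕ) → ∑ˢ (λ S → d * f S) ≡ d * ∑ˢ f
∑ˢ-*ˡ d f = trans (∑ˢ-cong λ S → *-comm d (f S)) (trans (∑ˢ-*ʳ f d) (*-comm _ d))

∑ˢ-positive : (f : Subset n → ℕ) → 0 < ∑ˢ f → ∃ λ S → 0 < f S
∑ˢ-positive {zero}  f 0<f = [] , 0<f
∑ˢ-positive {suc n} f 0<f with ∑ˢ (f ∘ (outside ∷_)) in eq
... | zero  = let S , p = ∑ˢ-positive (f ∘ (inside ∷_)) 0<f in inside ∷ S , p
... | suc _ =
  let S , p = ∑ˢ-positive (f ∘ (outside ∷_)) (subst (0 <_) (sym eq) z<s) in outside ∷ S , p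

𝟙-mono : (a? : Dec A) (b? : Dec B) → (A → B) → 𝟙 a? ≤ 𝟙 b?
𝟙-mono (yes a) b? f = ≤-reflexive (sym (𝟙-yes b? (f a)))
𝟙-mono (no _)  b? f = z≤n

term≤sum : (f : Fin n → ℕ) (v : Fin n) → f v ≤ sum f
term≤sum f zero    = m≤m+n (f zero) _
term≤sum f (suc v) = ≤-trans (term≤sum (f ∘ suc) v) (m≤n+m _ (f zero))

term≤∑ˢ : (f : Subset n → ℕ) (S : Subset n) → f S ≤ ∑ˢ f
term≤∑ˢ f []            = ≤-refl
term≤∑ˢ f (outside ∷ S) = ≤-trans (term≤∑ˢ (f ∘ (outside ∷_)) S) (m≤m+n _ _)
term≤∑ˢ f (inside  ∷ S) = ≤-trans (term≤∑ˢ (f ∘ (inside ∷_)) S) (m≤n+m _ _)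

module _ {P : Fin n → Set} (P? : ∀ v → Dec (P v)) where

  sum-positive : 0 < ∑[ v < n ] 𝟙 (P? v) → ∃ P
  sum-positive 0<∑ = decidable-stable (any? P?) λ ¬∃ →
    <⇒≢ 0<∑ (sym (sum-zero λ v → 𝟙-no (P? v) λ p → ¬∃ (v , p)))

  any-≤-sum : 𝟙 (any? P?) ≤ ∑[ v < n ] 𝟙 (P? v)
  any-≤-sum with any? P?
  ... | no  _       = z≤n
  ... | yes (v , p) = ≤-trans (≤-reflexive (sym (𝟙-yes (P? v) p))) (term≤sum (λ v → 𝟙 (P? v)) v)

  -- Turns an existential with at most one witness into a sum, which `∑-comm` can then exchange with
  -- another sum; the bijective counts below all rest on this.
  sum-unique : (∀ {v w} → P v → P w → v ≡ w) → ∑[ v < n ] 𝟙 (P? v) ≡ 𝟙 (any? P?)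
  sum-unique unique with any? P?
  ... | no  ¬∃      = sum-zero λ v → 𝟙-no (P? v) λ p → ¬∃ (v , p)
  ... | yes (v , p) = trans (sum-single _ v λ w w≢v → 𝟙-no (P? w) λ p′ → w≢v (unique p′ p))
                            (𝟙-yes (P? v) p)

  sum-complement : ∑[ v < n ] 𝟙 (¬? (P? v)) + ∑[ v < n ] 𝟙 (P? v) ≡ n
  sum-complement = trans (sym (∑-distrib-+ (λ v → 𝟙 (¬? (P? v))) (λ v → 𝟙 (P? v))))
    (trans (sum-cong-≗ one) sum-one)
    where
    one : ∀ v → 𝟙 (¬? (P? v)) + 𝟙 (P? v) ≡ 1
    one v with P? v
    ... | yes _ = refl
    ... | no  _ = refl

sum-≡ : (w : Fin n) → ∑[ v < n ] 𝟙 (w ≟ᶠ v) ≡ 1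
sum-≡ w = trans (sum-unique (w ≟ᶠ_) (λ p p′ → trans (sym p) p′)) (𝟙-yes (any? (w ≟ᶠ_)) (w , refl))

image-size : (f : Fin m → Fin n) → ∑[ v < n ] 𝟙 (any? (λ y → f y ≟ᶠ v)) ≤ m
image-size {m} {n} f = begin
  ∑[ v < n ] 𝟙 (any? (λ y → f y ≟ᶠ v))  ≤⟨ sum-mono (λ v → any-≤-sum (λ y → f y ≟ᶠ v)) ⟩
  ∑[ v < n ] ∑[ y < m ] 𝟙 (f y ≟ᶠ v)    ≡⟨ ∑-comm (λ v y → 𝟙 (f y ≟ᶠ v)) ⟩
  ∑[ y < m ] ∑[ v < n ] 𝟙 (f y ≟ᶠ v)    ≡⟨ sum-cong-≗ (λ y → sum-≡ (f y)) ⟩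
  ∑[ y < m ] 1                          ≡⟨ sum-one ⟩
  m                                     ∎
  where open ≤-Reasoning

injection-size : {P : Fin n → Set} (P? : ∀ v → Dec (P v)) (f : Fin m → Fin n) →
  (∀ {y z} → f y ≡ f z → y ≡ z) → (∀ y → P (f y)) → m ≤ ∑[ v < n ] 𝟙 (P? v)
injection-size {n} {m} {P} P? f inj Pf = begin
  m                                     ≡⟨ sum-one ⟨
  ∑[ y < m ] 1                          ≡⟨ sum-cong-≗ (λ y → sym (sum-≡ (f y))) ⟩
  ∑[ y < m ] ∑[ v < n ] 𝟙 (f y ≟ᶠ v)    ≡⟨ ∑-comm (λ y v → 𝟙 (f y ≟ᶠ v)) ⟩
  ∑[ v < n ] ∑[ y < m ] 𝟙 (f y ≟ᶠ v)
    ≡⟨ sum-cong-≗ (λ v → sum-unique (λ y → f y ≟ᶠ v) (λ p p′ → inj (trans p (sym p′)))) ⟩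
  ∑[ v < n ] 𝟙 (any? (λ y → f y ≟ᶠ v))
    ≤⟨ sum-mono (λ v → 𝟙-mono (any? (λ y → f y ≟ᶠ v)) (P? v) λ (y , p) → subst P p (Pf y)) ⟩
  ∑[ v < n ] 𝟙 (P? v)                   ∎
  where open ≤-Reasoning

∣∣-sum : (S : Subset n) → ∣ S ∣ ≡ ∑[ v < n ] 𝟙 (v ∈? S)
∣∣-sum []            = refl
∣∣-sum (inside  ∷ S) = cong suc (∣∣-sum S)
∣∣-sum (outside ∷ S) = ∣∣-sum S

-- Counting independent sets by their extensions

count-++ : (p : A → Bool) (xs ys : List A) → count p (xs List.++ ys) ≡ count p xs + count p ys
count-++ p []       ys = refl
count-++ p (x ∷ xs) ys with p x
... | true  = cong suc (count-++ p xs ys)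
... | false = count-++ p xs ys

count-map : (p : B → Bool) (f : A → B) (xs : List A) → count p (List.map f xs) ≡ count (p ∘ f) xs
count-map p f []       = refl
count-map p f (x ∷ xs) with p (f x)
... | true  = cong suc (count-map p f xs)
... | false = count-map p f xs

count-allSubsets : (p : Subset n → Bool) →
                   count p (allSubsets n) ≡ ∑ˢ (λ S → if p S then 1 else 0)
count-allSubsets {zero}  p with p []
... | true  = refl
... | false = refl
count-allSubsets {suc n} p = begin
  count p (List.map (outside ∷_) (allSubsets n) List.++ List.map (inside ∷_) (allSubsets n))
    ≡⟨ count-++ p (List.map (outside ∷_) (allSubsets n)) _ ⟩
  count p (List.map (outside ∷_) (allSubsets n)) + count p (List.map (inside ∷_) (allSubsets n))
    ≡⟨ cong₂ _+_ (count-map p _ (allSubsets n)) (count-map p _ (allSubsets n)) ⟩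
  count (p ∘ (outside ∷_)) (allSubsets n) + count (p ∘ (inside ∷_)) (allSubsets n)
    ≡⟨ cong₂ _+_ (count-allSubsets (p ∘ (outside ∷_))) (count-allSubsets (p ∘ (inside ∷_))) ⟩
  ∑ˢ (λ S → if p S then 1 else 0) ∎
  where open ≡-Reasoning

-- Counts the pairs (T , v) with v ∈ T, once from T and once from S = T ∖ v.
double-count : (g : Subset n → ℕ) →
  ∑ˢ (λ S → ∑[ v < n ] (𝟙 (¬? (v ∈? S)) * g (S [ v ]≔ inside))) ≡ ∑ˢ (λ T → ∣ T ∣ * g T)
double-count {zero}  g = refl
double-count {suc n} g = begin
  ∑ˢ (λ S → new S + E outside S) + ∑ˢ (E inside)
    ≡⟨ cong (_+ ∑ˢ (E inside)) (∑ˢ-distrib-+ new (E outside)) ⟩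
  (∑ˢ new + ∑ˢ (E outside)) + ∑ˢ (E inside)
    ≡⟨ cong₂ (λ x y → (∑ˢ new + x) + y)
         (double-count (g ∘ (outside ∷_))) (double-count (g ∘ (inside ∷_))) ⟩
  (∑ˢ new + ∑ˢ (D outside)) + ∑ˢ (D inside)
    ≡⟨ cong (_+ ∑ˢ (D inside)) (+-comm (∑ˢ new) _) ⟩
  (∑ˢ (D outside) + ∑ˢ new) + ∑ˢ (D inside)
    ≡⟨ +-assoc (∑ˢ (D outside)) _ _ ⟩
  ∑ˢ (D outside) + (∑ˢ new + ∑ˢ (D inside))
    ≡⟨ cong (∑ˢ (D outside) +_)
         (trans (sym (∑ˢ-distrib-+ new (D inside)))
                (∑ˢ-cong λ S → sym (*-distribʳ-+ (g (inside ∷ S)) 1 ∣ S ∣))) ⟩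
  ∑ˢ (D outside) + ∑ˢ (λ T → suc ∣ T ∣ * g (inside ∷ T)) ∎
  where
  open ≡-Reasoning
  -- The pairs whose inserted vertex is the head. Moved from the `outside` half to the `inside`
  -- half, they raise the factor `∣ S ∣` there to `suc ∣ S ∣`.
  new : Subset n → ℕ
  new S = 1 * g (inside ∷ S)
  D E : Bool → Subset n → ℕ
  D b T = ∣ T ∣ * g (b ∷ T)
  E b S = ∑[ v < n ] (𝟙 (¬? (v ∈? S)) * g (b ∷ (S [ v ]≔ inside)))

∣insert∣ : (S : Subset n) (v : Fin n) → v ∉ S → ∣ S [ v ]≔ inside ∣ ≡ suc ∣ S ∣
∣insert∣ (inside  ∷ S) zero    v∉S = contradiction here v∉S
∣insert∣ (outside ∷ S) zero    v∉S = refl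
∣insert∣ (inside  ∷ S) (suc v) v∉S = cong suc (∣insert∣ S v (v∉S ∘ there))
∣insert∣ (outside ∷ S) (suc v) v∉S = ∣insert∣ S v (v∉S ∘ there)

∈-insert⁻ : (S : Subset n) (v w : Fin n) → w ∈ S [ v ]≔ inside → w ≡ v ⊎ w ∈ S
∈-insert⁻ (_ ∷ S) zero    zero    here      = inj₁ refl
∈-insert⁻ (_ ∷ S) zero    (suc w) (there p) = inj₂ (there p)
∈-insert⁻ (_ ∷ S) (suc v) zero    here      = inj₂ here
∈-insert⁻ (_ ∷ S) (suc v) (suc w) (there p) with ∈-insert⁻ S v w p
... | inj₁ refl = inj₁ refl
... | inj₂ w∈S  = inj₂ (there w∈S)

⊆-insert : (S : Subset n) (v : Fin n) → S ⊆ S [ v ]≔ inside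
⊆-insert S v {w} w∈S with w ≟ᶠ v
... | yes refl = []≔-updates S v
... | no  w≢v  = []≔-minimal S w v w≢v w∈S

-- Independence and size as decidable predicates

reflects-map : ∀ {b} → (A → B) → (B → A) → Reflects A b → Reflects B b
reflects-map f g (ofʸ a)  = ofʸ (f a)
reflects-map f g (ofⁿ ¬a) = ofⁿ (¬a ∘ g)

memb-reflects : (S : Subset n) (v : Fin n) → Reflects (v ∈ S) (memb S v)
memb-reflects (true  ∷ S) zero    = ofʸ here
memb-reflects (false ∷ S) zero    = ofⁿ λ ()
memb-reflects (_     ∷ S) (suc v) = reflects-map there drop-there (memb-reflects S v)

allL-map : (p : B → Bool) (f : A → B) (xs : List A) → allL p (List.map f xs) ≡ allL (p ∘ f) xs
allL-map p f []       = refl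
allL-map p f (x ∷ xs) = cong (p (f x) ∧_) (allL-map p f xs)

allFins-reflects : {P : Fin n → Set} (p : Fin n → Bool) → (∀ v → Reflects (P v) (p v)) →
                   Reflects (∀ v → P v) (allL p (allFins n))
allFins-reflects {zero}  p r = ofʸ λ ()
allFins-reflects {suc n} p r
  rewrite allL-map p suc (allFins n)
  with p zero | r zero | allL (p ∘ suc) (allFins n) | allFins-reflects (p ∘ suc) (r ∘ suc)
... | false | ofⁿ ¬p₀ | _     | _       = ofⁿ λ f → ¬p₀ (f zero)
... | true  | ofʸ p₀  | false | ofⁿ ¬ps = ofⁿ λ f → ¬ps (f ∘ suc)
... | true  | ofʸ p₀  | true  | ofʸ ps  = ofʸ λ { zero → p₀ ; (suc v) → ps v }

independent-reflects : (G : Graph n) (S : Subset n) → Reflects (Independent G S) (independent? G S)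
independent-reflects G S = allFins-reflects _ λ u → allFins-reflects _ λ v → entry u v
  where
  entry : ∀ u v → Reflects (u ∈ S → v ∈ S → adj G u v ≡ false)
                           (not (memb S u ∧ memb S v ∧ adj G u v))
  entry u v with memb S u | memb-reflects S u | memb S v | memb-reflects S v | adj G u v
  ... | false | ofⁿ ¬u | _     | _      | _     = ofʸ λ u → contradiction u ¬u
  ... | true  | ofʸ _  | false | ofⁿ ¬v | _     = ofʸ λ _ v → contradiction v ¬v
  ... | true  | ofʸ _  | true  | ofʸ _  | false = ofʸ λ _ _ → refl
  ... | true  | ofʸ u  | true  | ofʸ v  | true  = ofⁿ λ f → contradiction (f u v) λ ()

indep? : (G : Graph n) (S : Subset n) → Dec (Independent G S)
indep? G S = independent? G S because independent-reflects G S

sizeIs-reflects : (k : ℕ) (S : Subset n) → Reflects (∣ S ∣ ≡ k) (sizeIs k S)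
sizeIs-reflects zero    []            = ofʸ refl
sizeIs-reflects (suc k) []            = ofⁿ λ ()
sizeIs-reflects k       (outside ∷ S) = sizeIs-reflects k S
sizeIs-reflects zero    (inside ∷ S)  = ofⁿ λ ()
sizeIs-reflects (suc k) (inside ∷ S)  = reflects-map (cong suc) suc-injective (sizeIs-reflects k S)

-- Assembled from the very Boolean tests that define `i`, so that `does` computes to the test inside
-- `count` and `i-∑ˢ` needs no conversion.
indepOfSize? : (G : Graph n) (k : ℕ) (S : Subset n) → Dec (Independent G S × ∣ S ∣ ≡ k)
indepOfSize? G k S = indep? G S ×-dec (sizeIs k S because sizeIs-reflects k S)

i-∑ˢ : (G : Graph n) (k : ℕ) → i k G ≡ ∑ˢ (λ S → 𝟙 (indepOfSize? G k S))
i-∑ˢ G k = count-allSubsets (λ S → independent? G S ∧ sizeIs k S)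

Extends : Graph n → Subset n → Fin n → Set
Extends G S v = v ∉ S × Independent G (S [ v ]≔ inside)

extends? : (G : Graph n) (S : Subset n) (v : Fin n) → Dec (Extends G S v)
extends? G S v = ¬? (v ∈? S) ×-dec indep? G (S [ v ]≔ inside)

extensions : Graph n → Subset n → ℕ
extensions {n} G S = ∑[ v < n ] 𝟙 (extends? G S v)

independent-⊆ : (G : Graph n) {S T : Subset n} → S ⊆ T → Independent G T → Independent G S
independent-⊆ G S⊆T ind u v u∈S v∈S = ind u v (S⊆T u∈S) (S⊆T v∈S)

-- An independent set of size `suc j` arises from exactly `suc j` pairs of an independent `j`-set
-- and a vertex extending it: remove any one of its members.
i-suc : (G : Graph n) (j : ℕ) →
        suc j * i (suc j) G ≡ ∑ˢ (λ S → 𝟙 (indepOfSize? G j S) * extensions G S)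
i-suc {n} G j = begin
  suc j * i (suc j) G
    ≡⟨ cong (suc j *_) (i-∑ˢ G (suc j)) ⟩
  suc j * ∑ˢ g
    ≡⟨ ∑ˢ-*ˡ (suc j) g ⟨
  ∑ˢ (λ T → suc j * g T)
    ≡⟨ ∑ˢ-cong size ⟩
  ∑ˢ (λ T → ∣ T ∣ * g T)
    ≡⟨ double-count g ⟨
  ∑ˢ (λ S → ∑[ v < n ] (𝟙 (¬? (v ∈? S)) * g (S [ v ]≔ inside)))
    ≡⟨ ∑ˢ-cong (λ S → sum-cong-≗ (term S)) ⟩
  ∑ˢ (λ S → ∑[ v < n ] (𝟙 (indepOfSize? G j S) * 𝟙 (extends? G S v)))
    ≡⟨ ∑ˢ-cong (λ S → sym (*-distribˡ-sum (𝟙 (indepOfSize? G j S)) (λ v → 𝟙 (extends? G S v)))) ⟩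
  ∑ˢ (λ S → 𝟙 (indepOfSize? G j S) * extensions G S) ∎
  where
  open ≡-Reasoning
  g : Subset n → ℕ
  g T = 𝟙 (indepOfSize? G (suc j) T)
  size : ∀ T → suc j * g T ≡ ∣ T ∣ * g T
  size T = trans (*-comm (suc j) (g T))
    (trans (𝟙-*-cong (indepOfSize? G (suc j) T) (λ (_ , sz) → sym sz)) (*-comm (g T) ∣ T ∣))
  term : ∀ S v → 𝟙 (¬? (v ∈? S)) * g (S [ v ]≔ inside) ≡ 𝟙 (indepOfSize? G j S) * 𝟙 (extends? G S v)
  term S v = trans (sym (𝟙-× (¬? (v ∈? S)) (indepOfSize? G (suc j) (S [ v ]≔ inside)))) (trans
    (𝟙-cong (¬? (v ∈? S) ×-dec indepOfSize? G (suc j) (S [ v ]≔ inside))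
            (indepOfSize? G j S ×-dec extends? G S v)
      (λ (v∉S , ind , sz) → (independent-⊆ G (⊆-insert S v) ind ,
         suc-injective (trans (sym (∣insert∣ S v v∉S)) sz)) , v∉S , ind)
      (λ ((_ , sz) , v∉S , ind) → v∉S , ind , trans (∣insert∣ S v v∉S) (cong suc sz)))
    (𝟙-× (indepOfSize? G j S) (extends? G S v)))

i-suc-≡ : (G : Graph n) (j d : ℕ) → (∀ S → Independent G S → ∣ S ∣ ≡ j → extensions G S ≡ d) →
          suc j * i (suc j) G ≡ i j G * d
i-suc-≡ G j d h = trans (i-suc G j)
  (trans (∑ˢ-cong λ S → 𝟙-*-cong (indepOfSize? G j S) λ (ind , sz) → h S ind sz)
  (trans (∑ˢ-*ʳ (λ S → 𝟙 (indepOfSize? G j S)) d) (cong (_* d) (sym (i-∑ˢ G j)))))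

i-suc-≥ : (G : Graph n) (j d : ℕ) → (∀ S → Independent G S → ∣ S ∣ ≡ j → d ≤ extensions G S) →
          i j G * d ≤ suc j * i (suc j) G
i-suc-≥ G j d h = begin
  i j G * d                                           ≡⟨ cong (_* d) (i-∑ˢ G j) ⟩
  ∑ˢ (λ S → 𝟙 (indepOfSize? G j S)) * d               ≡⟨ ∑ˢ-*ʳ (λ S → 𝟙 (indepOfSize? G j S)) d ⟨
  ∑ˢ (λ S → 𝟙 (indepOfSize? G j S) * d)
    ≤⟨ ∑ˢ-mono (λ S → 𝟙-*-mono (indepOfSize? G j S) λ (ind , sz) → h S ind sz) ⟩
  ∑ˢ (λ S → 𝟙 (indepOfSize? G j S) * extensions G S)  ≡⟨ i-suc G j ⟨
  suc j * i (suc j) G                                 ∎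
  where
  open ≤-Reasoning

-- Joins

joinAdj : Graph m → Graph n → Fin m ⊎ Fin n → Fin m ⊎ Fin n → Bool
joinAdj G H (inj₁ u) (inj₁ v) = adj G u v
joinAdj G H (inj₁ _) (inj₂ _) = true
joinAdj G H (inj₂ _) (inj₁ _) = true
joinAdj G H (inj₂ u) (inj₂ v) = adj H u v

joinAdj-symm : (G : Graph m) (H : Graph n) → ∀ u v → joinAdj G H u v ≡ joinAdj G H v u
joinAdj-symm G H (inj₁ u) (inj₁ v) = symm G u v
joinAdj-symm G H (inj₁ _) (inj₂ _) = refl
joinAdj-symm G H (inj₂ _) (inj₁ _) = refl
joinAdj-symm G H (inj₂ u) (inj₂ v) = symm H u v

joinAdj-irrefl : (G : Graph m) (H : Graph n) → ∀ v → joinAdj G H v v ≡ false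
joinAdj-irrefl G H (inj₁ v) = irrefl G v
joinAdj-irrefl G H (inj₂ v) = irrefl H v

join : Graph m → Graph n → Graph (m + n)
join {m} G H = record
  { adj    = λ u v → joinAdj G H (splitAt m u) (splitAt m v)
  ; symm   = λ u v → joinAdj-symm G H (splitAt m u) (splitAt m v)
  ; irrefl = λ v → joinAdj-irrefl G H (splitAt m v)
  }

∈-++ˡ : {S : Subset m} (T : Subset n) {u : Fin m} → u ∈ S → u ↑ˡ n ∈ S ++ T
∈-++ˡ T here      = here
∈-++ˡ T (there p) = there (∈-++ˡ T p)

∈-++ˡ⁻ : (S : Subset m) {T : Subset n} {u : Fin m} → u ↑ˡ n ∈ S ++ T → u ∈ S
∈-++ˡ⁻ (_ ∷ S) {u = zero}  here      = here
∈-++ˡ⁻ (_ ∷ S) {u = suc u} (there p) = there (∈-++ˡ⁻ S p)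

∈-++ʳ : (S : Subset m) {T : Subset n} {v : Fin n} → v ∈ T → m ↑ʳ v ∈ S ++ T
∈-++ʳ []      p = p
∈-++ʳ (_ ∷ S) p = there (∈-++ʳ S p)

∈-++ʳ⁻ : (S : Subset m) {T : Subset n} {v : Fin n} → m ↑ʳ v ∈ S ++ T → v ∈ T
∈-++ʳ⁻ []      p         = p
∈-++ʳ⁻ (_ ∷ S) (there p) = ∈-++ʳ⁻ S p

∣++∣ : (S : Subset m) (T : Subset n) → ∣ S ++ T ∣ ≡ ∣ S ∣ + ∣ T ∣
∣++∣ []            T = refl
∣++∣ (inside  ∷ S) T = cong suc (∣++∣ S T)
∣++∣ (outside ∷ S) T = ∣++∣ S T

insert-++ˡ : (S : Subset m) (T : Subset n) (u : Fin m) →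
             (S ++ T) [ u ↑ˡ n ]≔ inside ≡ (S [ u ]≔ inside) ++ T
insert-++ˡ (_ ∷ S) T zero    = refl
insert-++ˡ (b ∷ S) T (suc u) = cong (b ∷_) (insert-++ˡ S T u)

insert-++ʳ : (S : Subset m) (T : Subset n) (v : Fin n) →
             (S ++ T) [ m ↑ʳ v ]≔ inside ≡ S ++ (T [ v ]≔ inside)
insert-++ʳ []      T v = refl
insert-++ʳ (b ∷ S) T v = cong (b ∷_) (insert-++ʳ S T v)

Empty⇒∣∣≡0 : (S : Subset n) → Empty S → ∣ S ∣ ≡ 0
Empty⇒∣∣≡0 []            _ = refl
Empty⇒∣∣≡0 (outside ∷ S) e = Empty⇒∣∣≡0 S λ (v , v∈S) → e (suc v , there v∈S)
Empty⇒∣∣≡0 (inside  ∷ S) e = contradiction (zero , here) e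

∣∣>0⇒Nonempty : (S : Subset n) → 0 < ∣ S ∣ → Nonempty S
∣∣>0⇒Nonempty (inside  ∷ S) _ = zero , here
∣∣>0⇒Nonempty (outside ∷ S) p with v , v∈S ← ∣∣>0⇒Nonempty S p = suc v , there v∈S

module _ (G : Graph m) (H : Graph n) where

  indep-joinˡ : {S : Subset m} {T : Subset n} → Independent G S → Empty T →
                Independent (join G H) (S ++ T)
  indep-joinˡ {S} {T} ind e u v u∈ v∈ with splitAt m u in equ | splitAt m v in eqv
  ... | inj₁ u′ | inj₁ v′ = ind u′ v′
    (∈-++ˡ⁻ S (subst (_∈ S ++ T) (sym (splitAt⁻¹-↑ˡ equ)) u∈))
    (∈-++ˡ⁻ S (subst (_∈ S ++ T) (sym (splitAt⁻¹-↑ˡ eqv)) v∈))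
  ... | inj₂ u′ | _ =
    contradiction (u′ , ∈-++ʳ⁻ S (subst (_∈ S ++ T) (sym (splitAt⁻¹-↑ʳ equ)) u∈)) e
  ... | inj₁ u′ | inj₂ v′ =
    contradiction (v′ , ∈-++ʳ⁻ S (subst (_∈ S ++ T) (sym (splitAt⁻¹-↑ʳ eqv)) v∈)) e

  indep-joinʳ : {S : Subset m} {T : Subset n} → Empty S → Independent H T →
                Independent (join G H) (S ++ T)
  indep-joinʳ {S} {T} e ind u v u∈ v∈ with splitAt m u in equ | splitAt m v in eqv
  ... | inj₂ u′ | inj₂ v′ = ind u′ v′
    (∈-++ʳ⁻ S (subst (_∈ S ++ T) (sym (splitAt⁻¹-↑ʳ equ)) u∈))
    (∈-++ʳ⁻ S (subst (_∈ S ++ T) (sym (splitAt⁻¹-↑ʳ eqv)) v∈))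
  ... | inj₁ u′ | _ =
    contradiction (u′ , ∈-++ˡ⁻ S (subst (_∈ S ++ T) (sym (splitAt⁻¹-↑ˡ equ)) u∈)) e
  ... | inj₂ u′ | inj₁ v′ =
    contradiction (v′ , ∈-++ˡ⁻ S (subst (_∈ S ++ T) (sym (splitAt⁻¹-↑ˡ eqv)) v∈)) e

  indep-join⁻ : (S : Subset m) (T : Subset n) → Independent (join G H) (S ++ T) →
                (Independent G S × Empty T) ⊎ (Empty S × Independent H T)
  indep-join⁻ S T ind with nonempty? S
  ... | no ¬S = inj₂ (¬S , indT)
    where
    indT : Independent H T
    indT u v u∈ v∈ = trans
      (sym (cong₂ (joinAdj G H) (splitAt-↑ʳ m n u) (splitAt-↑ʳ m n v)))
      (ind (m ↑ʳ u) (m ↑ʳ v) (∈-++ʳ S u∈) (∈-++ʳ S v∈))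
  ... | yes (w , w∈) = inj₁ (indS , emptyT)
    where
    indS : Independent G S
    indS u v u∈ v∈ = trans
      (sym (cong₂ (joinAdj G H) (splitAt-↑ˡ m u n) (splitAt-↑ˡ m v n)))
      (ind (u ↑ˡ n) (v ↑ˡ n) (∈-++ˡ T u∈) (∈-++ˡ T v∈))
    emptyT : Empty T
    emptyT (v , v∈) = contradiction (trans
      (sym (cong₂ (joinAdj G H) (splitAt-↑ˡ m w n) (splitAt-↑ʳ m n v)))
      (ind (w ↑ˡ n) (m ↑ʳ v) (∈-++ˡ T w∈) (∈-++ʳ S v∈))) λ ()

∑ˢ-++ : (f : Subset (m + n) → ℕ) →
        ∑ˢ f ≡ ∑ˢ (λ (S : Subset m) → ∑ˢ (λ (T : Subset n) → f (S ++ T)))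
∑ˢ-++ {zero}  f = refl
∑ˢ-++ {suc m} f = cong₂ _+_ (∑ˢ-++ {m} (f ∘ (outside ∷_))) (∑ˢ-++ {m} (f ∘ (inside ∷_)))

empty? : (S : Subset n) → Dec (Empty S)
empty? S = ¬? (nonempty? S)

∑ˢ-zero : {f : Subset n → ℕ} → (∀ S → f S ≡ 0) → ∑ˢ f ≡ 0
∑ˢ-zero {zero}  f≡0 = f≡0 []
∑ˢ-zero {suc n} f≡0 = cong₂ _+_ (∑ˢ-zero (f≡0 ∘ (outside ∷_))) (∑ˢ-zero (f≡0 ∘ (inside ∷_)))

∑ˢ-empty : ∑ˢ {n} (λ S → 𝟙 (empty? S)) ≡ 1
∑ˢ-empty {zero}  = refl
∑ˢ-empty {suc n} = cong₂ _+_
  (trans (∑ˢ-cong λ (S : Subset n) → 𝟙-cong (empty? (outside ∷ S)) (empty? S)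
            (λ e (v , v∈) → e (suc v , there v∈)) (λ { e (suc v , there v∈) → e (v , v∈) }))
         (∑ˢ-empty {n}))
  (∑ˢ-zero λ (S : Subset n) → 𝟙-no (empty? (inside ∷ S)) λ e → e (zero , here))

-- Fails for size 0: the empty set would be counted twice on the right.
i-join : (G : Graph m) (H : Graph n) (j : ℕ) →
         i (suc j) (join G H) ≡ i (suc j) G + i (suc j) H
i-join {m} {n} G H j = begin
  i (suc j) (join G H)
    ≡⟨ trans (i-∑ˢ (join G H) (suc j)) (∑ˢ-++ {m} {n} (λ U → 𝟙 (indepOfSize? (join G H) (suc j) U))) ⟩
  ∑ˢ (λ (S : Subset m) → ∑ˢ (λ (T : Subset n) → 𝟙 (indepOfSize? (join G H) (suc j) (S ++ T))))
    ≡⟨ ∑ˢ-cong (λ (S : Subset m) → ∑ˢ-cong (λ (T : Subset n) → split S T)) ⟩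
  ∑ˢ (λ (S : Subset m) → ∑ˢ (λ (T : Subset n) → g S * 𝟙 (empty? T) + 𝟙 (empty? S) * h T))
    ≡⟨ ∑ˢ-cong (λ (S : Subset m) → ∑ˢ-distrib-+
         (λ (T : Subset n) → g S * 𝟙 (empty? T)) (λ (T : Subset n) → 𝟙 (empty? S) * h T)) ⟩
  ∑ˢ (λ (S : Subset m) →
    ∑ˢ (λ (T : Subset n) → g S * 𝟙 (empty? T)) + ∑ˢ (λ (T : Subset n) → 𝟙 (empty? S) * h T))
    ≡⟨ ∑ˢ-cong (λ (S : Subset m) → cong₂ _+_
         (trans (∑ˢ-*ˡ (g S) (λ (T : Subset n) → 𝟙 (empty? T)))
                (trans (cong (g S *_) (∑ˢ-empty {n})) (*-identityʳ (g S))))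
         (∑ˢ-*ˡ (𝟙 (empty? S)) h)) ⟩
  ∑ˢ (λ (S : Subset m) → g S + 𝟙 (empty? S) * ∑ˢ h)
    ≡⟨ ∑ˢ-distrib-+ g (λ (S : Subset m) → 𝟙 (empty? S) * ∑ˢ h) ⟩
  ∑ˢ g + ∑ˢ (λ (S : Subset m) → 𝟙 (empty? S) * ∑ˢ h)
    ≡⟨ cong (∑ˢ g +_) (trans (∑ˢ-*ʳ (λ (S : Subset m) → 𝟙 (empty? S)) (∑ˢ h))
         (trans (cong (_* ∑ˢ h) (∑ˢ-empty {m})) (*-identityˡ _))) ⟩
  ∑ˢ g + ∑ˢ h
    ≡⟨ cong₂ _+_ (i-∑ˢ G (suc j)) (i-∑ˢ H (suc j)) ⟨
  i (suc j) G + i (suc j) H ∎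
  where
  open ≡-Reasoning
  g : Subset m → ℕ
  g S = 𝟙 (indepOfSize? G (suc j) S)
  h : Subset n → ℕ
  h T = 𝟙 (indepOfSize? H (suc j) T)
  ∣++∣-emptyʳ : ∀ (S : Subset m) (T : Subset n) → Empty T → ∣ S ++ T ∣ ≡ ∣ S ∣
  ∣++∣-emptyʳ S T e = trans (∣++∣ S T) (trans (cong (∣ S ∣ +_) (Empty⇒∣∣≡0 T e)) (+-identityʳ _))
  ∣++∣-emptyˡ : ∀ (S : Subset m) (T : Subset n) → Empty S → ∣ S ++ T ∣ ≡ ∣ T ∣
  ∣++∣-emptyˡ S T e = trans (∣++∣ S T) (cong (_+ ∣ T ∣) (Empty⇒∣∣≡0 S e))
  split : ∀ S T → 𝟙 (indepOfSize? (join G H) (suc j) (S ++ T)) ≡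
                  g S * 𝟙 (empty? T) + 𝟙 (empty? S) * h T
  split S T = trans
    (𝟙-⊎ (indepOfSize? (join G H) (suc j) (S ++ T))
         (indepOfSize? G (suc j) S ×-dec empty? T) (empty? S ×-dec indepOfSize? H (suc j) T)
         to from
         λ (((_ , sz) , _) , e , _) → 1+n≢0 (trans (sym sz) (Empty⇒∣∣≡0 S e)))
    (cong₂ _+_ (𝟙-× (indepOfSize? G (suc j) S) (empty? T))
               (𝟙-× (empty? S) (indepOfSize? H (suc j) T)))
    where
    Left Right : Set
    Left  = (Independent G S × ∣ S ∣ ≡ suc j) × Empty T
    Right = Empty S × (Independent H T × ∣ T ∣ ≡ suc j)
    to : Independent (join G H) (S ++ T) × ∣ S ++ T ∣ ≡ suc j → Left ⊎ Right
    to (ind , sz) with indep-join⁻ G H S T ind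
    ... | inj₁ (indS , e) = inj₁ ((indS , trans (sym (∣++∣-emptyʳ S T e)) sz) , e)
    ... | inj₂ (e , indT) = inj₂ (e , (indT , trans (sym (∣++∣-emptyˡ S T e)) sz))
    from : Left ⊎ Right → Independent (join G H) (S ++ T) × ∣ S ++ T ∣ ≡ suc j
    from (inj₁ ((indS , sz) , e)) = indep-joinˡ G H indS e , trans (∣++∣-emptyʳ S T e) sz
    from (inj₂ (e , (indT , sz))) = indep-joinʳ G H e indT , trans (∣++∣-emptyˡ S T e) sz

-- Purity, a form of well-coveredness stable under joins

nonempty-++ˡ : (S : Subset m) (T : Subset n) (w : Fin (m + n)) → w ∈ S ++ T → Empty T → Nonempty S
nonempty-++ˡ {m} S T w w∈ e with splitAt m w in eq
... | inj₁ u = u , ∈-++ˡ⁻ S (subst (_∈ S ++ T) (sym (splitAt⁻¹-↑ˡ eq)) w∈)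
... | inj₂ u = contradiction (u , ∈-++ʳ⁻ S (subst (_∈ S ++ T) (sym (splitAt⁻¹-↑ʳ eq)) w∈)) e

nonempty-++ʳ : (S : Subset m) (T : Subset n) (w : Fin (m + n)) → w ∈ S ++ T → Empty S → Nonempty T
nonempty-++ʳ {m} S T w w∈ e with splitAt m w in eq
... | inj₂ u = u , ∈-++ʳ⁻ S (subst (_∈ S ++ T) (sym (splitAt⁻¹-↑ʳ eq)) w∈)
... | inj₁ u = contradiction (u , ∈-++ˡ⁻ S (subst (_∈ S ++ T) (sym (splitAt⁻¹-↑ˡ eq)) w∈)) e

-- The graph on no vertices qualifies for every q.
record Pure (q : ℕ) (G : Graph n) : Set where
  field
    bounded : ∀ S → Independent G S → ∣ S ∣ ≤ q
    extend  : ∀ S → Independent G S → Nonempty S → ∣ S ∣ < q → ∃ (Extends G S)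

open Pure public

join-pure : {G : Graph m} {H : Graph n} → Pure q G → Pure q H → Pure q (join G H)
join-pure {m} {n} {q} {G} {H} pG pH = record { bounded = bnd ; extend = ext }
  where
  bnd : ∀ S → Independent (join G H) S → ∣ S ∣ ≤ q
  bnd U ind with S , T , refl ← Vec.splitAt m U with indep-join⁻ G H S T ind
  ... | inj₁ (indS , e) rewrite ∣++∣ S T | Empty⇒∣∣≡0 T e | +-identityʳ ∣ S ∣ = bounded pG S indS
  ... | inj₂ (e , indT) rewrite ∣++∣ S T | Empty⇒∣∣≡0 S e = bounded pH T indT
  ext : ∀ S → Independent (join G H) S → Nonempty S → ∣ S ∣ < q → ∃ (Extends (join G H) S)
  ext U ind (w , w∈) lt with S , T , refl ← Vec.splitAt m U with indep-join⁻ G H S T ind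
  ... | inj₁ (indS , e) rewrite ∣++∣ S T | Empty⇒∣∣≡0 T e | +-identityʳ ∣ S ∣
    with v , v∉S , ind′ ← extend pG S indS (nonempty-++ˡ S T w w∈ e) lt =
      v ↑ˡ n , v∉S ∘ ∈-++ˡ⁻ S ,
      subst (Independent (join G H)) (sym (insert-++ˡ S T v)) (indep-joinˡ G H ind′ e)
  ... | inj₂ (e , indT) rewrite ∣++∣ S T | Empty⇒∣∣≡0 S e
    with v , v∉T , ind′ ← extend pH T indT (nonempty-++ʳ S T w w∈ e) lt =
      m ↑ʳ v , v∉T ∘ ∈-++ʳ⁻ S ,
      subst (Independent (join G H)) (sym (insert-++ʳ S T v)) (indep-joinʳ G H e ind′)

module _ {G : Graph n} (q>0 : 0 < q) (pG : Pure q G) (i>0 : 0 < i q G) where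

  witness : ∃ λ S → Independent G S × ∣ S ∣ ≡ q
  witness with S , p ← ∑ˢ-positive (λ S → 𝟙 (indepOfSize? G q S)) (subst (0 <_) (i-∑ˢ G q) i>0)
    = S , decidable-stable (indepOfSize? G q S) λ ¬p →
        n≮0 (subst (0 <_) (𝟙-no (indepOfSize? G q S) ¬p) p)

  pure-independenceNumber : IndependenceNumber G q
  pure-independenceNumber = witness , bounded pG

  maximal-size : ∀ S → MaximalIndependent G S → ∣ S ∣ ≡ q
  maximal-size S (ind , maximal) with ∣ S ∣ <? q
  ... | no  ≮ = ≤-antisym (bounded pG S ind) (≮⇒≥ ≮)
  ... | yes < with nonempty? S
  ...   | yes ne with v , v∉S , ind′ ← extend pG S ind ne < =
    contradiction (maximal (S [ v ]≔ inside) ind′ (⊆-insert S v) ([]≔-updates S v)) v∉S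
  -- `Pure` does not extend the empty set, but the witness of size `q > 0` does, so the empty set is
  -- not maximal.
  ...   | no  ¬ne with T , indT , refl ← witness =
    contradiction (let v , v∈T = ∣∣>0⇒Nonempty T q>0 in
                   v , maximal T indT (λ {w} w∈S → contradiction (w , w∈S) ¬ne) v∈T) ¬ne

  pure-wellCovered : WellCovered G
  pure-wellCovered S T maxS maxT = trans (maximal-size S maxS) (sym (maximal-size T maxT))

-- Graphs of partial words

-- The vertices of a graph must fill some `Fin size`, whereas the codes of partial words form only a
-- decidable part of a larger `Fin n`.
record Enumeration (P : Fin n → Set) : Set where
  field
    size      : ℕ
    element   : Fin size → Fin n
    sound     : ∀ y → P (element y)
    complete  : ∀ {v} → P v → ∃ λ y → element y ≡ v
    injective : ∀ {y z} → element y ≡ element z → y ≡ z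

enumerate : {P : Fin n → Set} → (∀ v → Dec (P v)) → Enumeration P
enumerate {zero}  P? = record
  { size = 0 ; element = λ () ; sound = λ () ; complete = λ { {()} } ; injective = λ { {()} } }
enumerate {suc n} {P} P? with P? zero | enumerate (P? ∘ suc)
... | no ¬p₀ | E = record
  { size      = E.size
  ; element   = suc ∘ E.element
  ; sound     = E.sound
  ; complete  = complete
  ; injective = E.injective ∘ sucᶠ-injective
  }
  where
  module E = Enumeration E
  complete : ∀ {v} → P v → ∃ λ y → suc (E.element y) ≡ v
  complete {zero}  p = contradiction p ¬p₀
  complete {suc v} p = let y , eq = E.complete p in y , cong suc eq
... | yes p₀ | E = record
  { size      = suc E.size
  ; element   = element
  ; sound     = λ { zero → p₀ ; (suc y) → E.sound y }
  ; complete  = complete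
  ; injective = injective
  }
  where
  module E = Enumeration E
  element : Fin (suc E.size) → Fin (suc n)
  element zero    = zero
  element (suc y) = suc (E.element y)
  complete : ∀ {v} → P v → ∃ λ y → element y ≡ v
  complete {zero}  p = zero , refl
  complete {suc v} p = let y , eq = E.complete p in suc y , cong suc eq
  injective : ∀ {y z} → element y ≡ element z → y ≡ z
  injective {zero}  {zero}  _ = refl
  injective {suc y} {suc z} p = cong suc (E.injective (sucᶠ-injective p))

funToFin-cong : {f g : Fin m → Fin n} → (∀ s → f s ≡ g s) → funToFin f ≡ funToFin g
funToFin-cong {zero}  f≗g = refl
funToFin-cong {suc m} f≗g = cong₂ combine (f≗g zero) (funToFin-cong (f≗g ∘ suc))

-- A vertex is a colour i together with a value for each coordinate visible from i.
record Vertices (q c l : ℕ) (Visible : Fin q → Fin c → Set) : Set where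
  field
    size          : ℕ
    colour        : Fin size → Fin q
    value         : Fin size → Fin c → Fin l
    vertex        : Fin q → (Fin c → Fin l) → Fin size
    colour-vertex : ∀ i x → colour (vertex i x) ≡ i
    value-vertex  : ∀ i x {s} → Visible i s → value (vertex i x) s ≡ x s
    vertex-≡      : ∀ {u v} → colour u ≡ colour v →
                    (∀ {s} → Visible (colour u) s → value u s ≡ value v s) → u ≡ v

-- Invisible coordinates are normalised to zero.
vertices : {q c l : ℕ} {Visible : Fin q → Fin c → Set} → (∀ i s → Dec (Visible i s)) →
           Vertices q c (suc l) Visible
vertices {q} {c} {l} {Visible} visible? = record
  { size          = E.size
  ; colour        = colour′ ∘ E.element
  ; value         = value′ ∘ E.element
  ; vertex        = λ i x → proj₁ (E.complete (canonical-code i x))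
  ; colour-vertex = λ i x →
      trans (cong colour′ (proj₂ (E.complete (canonical-code i x)))) (colour-code i x)
  ; value-vertex  = λ i x {s} vis →
      trans (cong (λ w → value′ w s) (proj₂ (E.complete (canonical-code i x))))
            (trans (value-code i x s) (mask-visible i x vis))
  ; vertex-≡      = λ {u} {v} eq vals → E.injective
      (code-≡ (E.element u) (E.element v) (E.sound u) (E.sound v) eq vals)
  }
  where
  Code : Set
  Code = Fin (q * suc l ^ c)
  colour′ : Code → Fin q
  colour′ w = proj₁ (remQuot (suc l ^ c) w)
  value′ : Code → Fin c → Fin (suc l)
  value′ w = finToFun (proj₂ (remQuot {q} (suc l ^ c) w))
  Canonical : Code → Set
  Canonical w = ∀ s → ¬ Visible (colour′ w) s → value′ w s ≡ zero
  module E = Enumeration (enumerate {P = Canonical}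
    λ w → all? λ s → ¬? (visible? (colour′ w) s) →-dec (value′ w s ≟ᶠ zero))
  mask : Fin q → (Fin c → Fin (suc l)) → Fin c → Fin (suc l)
  mask i x s with visible? i s
  ... | yes _ = x s
  ... | no  _ = zero
  mask-visible : ∀ i x {s} → Visible i s → mask i x s ≡ x s
  mask-visible i x {s} vis with visible? i s
  ... | yes _   = refl
  ... | no ¬vis = contradiction vis ¬vis
  mask-invisible : ∀ i x {s} → ¬ Visible i s → mask i x s ≡ zero
  mask-invisible i x {s} ¬vis with visible? i s
  ... | yes vis = contradiction vis ¬vis
  ... | no  _   = refl
  code : Fin q → (Fin c → Fin (suc l)) → Code
  code i x = combine i (funToFin (mask i x))
  colour-code : ∀ i x → colour′ (code i x) ≡ i
  colour-code i x = cong proj₁ (remQuot-combine i (funToFin (mask i x)))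
  value-code : ∀ i x s → value′ (code i x) s ≡ mask i x s
  value-code i x s = trans
    (cong (λ p → finToFun (proj₂ p) s) (remQuot-combine i (funToFin (mask i x))))
    (finToFun-funToFin (mask i x) s)
  canonical-code : ∀ i x → Canonical (code i x)
  canonical-code i x s ¬vis = trans (value-code i x s)
    (mask-invisible i x (¬vis ∘ subst (λ i → Visible i s) (sym (colour-code i x))))
  code-≡ : ∀ u v → Canonical u → Canonical v → colour′ u ≡ colour′ v →
           (∀ {s} → Visible (colour′ u) s → value′ u s ≡ value′ v s) → u ≡ v
  code-≡ u v can-u can-v eq vals = trans (sym (combine-remQuot {q} (suc l ^ c) u))
    (trans (cong₂ combine eq rest) (combine-remQuot {q} (suc l ^ c) v))
    where
    all-equal : ∀ s → value′ u s ≡ value′ v s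
    all-equal s with visible? (colour′ u) s
    ... | yes vis = vals vis
    ... | no ¬vis = trans (can-u s ¬vis) (sym (can-v s (¬vis ∘ subst (λ i → Visible i s) (sym eq))))
    rest : proj₂ (remQuot {q} (suc l ^ c) u) ≡ proj₂ (remQuot {q} (suc l ^ c) v)
    rest = trans (sym (funToFin-finToFin {c} {suc l} _))
      (trans (funToFin-cong all-equal) (funToFin-finToFin {c} {suc l} _))

-- Independent sets of partial words and their extensions

module CoordinateGraph {q c l : ℕ} {Visible : Fin q → Fin c → Set}
  (visible? : ∀ i s → Dec (Visible i s)) (V : Vertices q c l Visible) where

  open Vertices V

  -- Adjacency will be the complement of this relation, so an independent set consists of views in
  -- distinct colours that agree where they overlap and can be glued together.
  Compatible : Fin size → Fin size → Set
  Compatible u v =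
    colour u ≢ colour v ×
    (∀ s → Visible (colour u) s → Visible (colour v) s → value u s ≡ value v s)

  compatible? : ∀ u v → Dec (Compatible u v)
  compatible? u v = ¬? (colour u ≟ᶠ colour v) ×-dec
    all? λ s → visible? (colour u) s →-dec (visible? (colour v) s →-dec (value u s ≟ᶠ value v s))

  compatible-sym : ∀ {u v} → Compatible u v → Compatible v u
  compatible-sym (≢ , agree) = ≢ ∘ sym , λ s visv visu → sym (agree s visu visv)

  adjacent? : ∀ u v → Dec (u ≢ v × ¬ Compatible u v)
  adjacent? u v = ¬? (u ≟ᶠ v) ×-dec ¬? (compatible? u v)

  graph : Graph size
  graph = record
    { adj    = λ u v → does (adjacent? u v)
    ; symm   = λ u v → does-⇔ (mk⇔ flip flip) (adjacent? u v) (adjacent? v u)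
    ; irrefl = λ v → dec-false (adjacent? v v) λ (≢ , _) → ≢ refl
    }
    where
    flip : ∀ {u v} → u ≢ v × ¬ Compatible u v → v ≢ u × ¬ Compatible v u
    flip (≢ , ¬c) = ≢ ∘ sym , ¬c ∘ compatible-sym

  independent⁻ : ∀ {S} → Independent graph S → ∀ {u v} → u ∈ S → v ∈ S → u ≢ v → Compatible u v
  independent⁻ ind {u} {v} u∈S v∈S u≢v = decidable-stable (compatible? u v) λ ¬c →
    contradiction (trans (sym (dec-true (adjacent? u v) (u≢v , ¬c))) (ind u v u∈S v∈S)) λ ()

  independent⁺ : ∀ {S} → (∀ {u v} → u ∈ S → v ∈ S → u ≢ v → Compatible u v) → Independent graph S
  independent⁺ comp u v u∈S v∈S =
    dec-false (adjacent? u v) λ (≢ , ¬c) → ¬c (comp u∈S v∈S ≢)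

  module _ (S : Subset size) where

    Used : Fin q → Set
    Used i = ∃ λ v → v ∈ S × colour v ≡ i

    used? : ∀ i → Dec (Used i)
    used? i = any? λ v → (v ∈? S) ×-dec (colour v ≟ᶠ i)

    Known : Fin c → Set
    Known s = ∃ λ v → v ∈ S × Visible (colour v) s

    known? : ∀ s → Dec (Known s)
    known? s = any? λ v → (v ∈? S) ×-dec visible? (colour v) s

    unused : ℕ
    unused = ∑[ i < q ] 𝟙 (¬? (used? i))

    -- The word glued from the members of `S`. The letter `y` fills the coordinates that no member
    -- sees; varying it is what produces many extensions.
    complete-by : Fin l → Fin c → Fin l
    complete-by y s with known? s
    ... | yes (v , _) = value v s
    ... | no _        = y

    module _ (ind : Independent graph S) where

      same-colour : ∀ {u v} → u ∈ S → v ∈ S → colour u ≡ colour v → u ≡ v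
      same-colour {u} {v} u∈S v∈S eq = decidable-stable (u ≟ᶠ v) λ u≢v →
        proj₁ (independent⁻ ind u∈S v∈S u≢v) eq

      -- Members of an independent set have distinct colours, so pairs of a colour and a member
      -- carrying it are counted by either component.
      used-count : ∑[ i < q ] 𝟙 (used? i) ≡ ∣ S ∣
      used-count = begin
        ∑[ i < q ] 𝟙 (used? i)
          ≡⟨ sum-cong-≗ (λ i → sum-unique (λ v → (v ∈? S) ×-dec (colour v ≟ᶠ i))
               λ (u∈ , p) (v∈ , p′) → same-colour u∈ v∈ (trans p (sym p′))) ⟨
        ∑[ i < q ] ∑[ v < size ] 𝟙 ((v ∈? S) ×-dec (colour v ≟ᶠ i))
          ≡⟨ ∑-comm (λ i v → 𝟙 ((v ∈? S) ×-dec (colour v ≟ᶠ i))) ⟩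
        ∑[ v < size ] ∑[ i < q ] 𝟙 ((v ∈? S) ×-dec (colour v ≟ᶠ i))
          ≡⟨ sum-cong-≗ (λ v → trans
               (sum-unique (λ i → (v ∈? S) ×-dec (colour v ≟ᶠ i)) λ (_ , p) (_ , p′) → trans (sym p) p′)
               (𝟙-cong (any? λ i → (v ∈? S) ×-dec (colour v ≟ᶠ i)) (v ∈? S)
                  (λ (_ , v∈ , _) → v∈) (λ v∈ → colour v , v∈ , refl))) ⟩
        ∑[ v < size ] 𝟙 (v ∈? S)
          ≡⟨ ∣∣-sum S ⟨
        ∣ S ∣ ∎
        where open ≡-Reasoning

      unused-count : unused + ∣ S ∣ ≡ q
      unused-count = trans (cong (unused +_) (sym used-count)) (sum-complement used?)

      exists-unused : ∣ S ∣ < q → ∃ λ i → ¬ Used i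
      exists-unused lt = sum-positive (λ i → ¬? (used? i))
        (+-cancelʳ-< ∣ S ∣ 0 unused (subst (∣ S ∣ <_) (sym unused-count) lt))

      known-value : ∀ y {v s} → v ∈ S → Visible (colour v) s → complete-by y s ≡ value v s
      known-value y {v} {s} v∈S vis with known? s
      ... | no ¬known = contradiction (v , v∈S , vis) ¬known
      ... | yes (u , u∈S , vis′) with u ≟ᶠ v
      ...   | yes refl = refl
      ...   | no  u≢v  = proj₂ (independent⁻ ind u∈S v∈S u≢v) s vis′ vis

      unknown-value : ∀ y {s} → ¬ Known s → complete-by y s ≡ y
      unknown-value y {s} ¬known with known? s
      ... | yes known = contradiction known ¬known
      ... | no  _     = refl

      compatible⇒extends : ∀ {v} → (∀ {u} → u ∈ S → Compatible v u) → Extends graph S v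
      compatible⇒extends {v} comp = v∉S , independent⁺ pairs
        where
        v∉S : v ∉ S
        v∉S v∈S = proj₁ (comp v∈S) refl
        pairs : ∀ {u w} → u ∈ S [ v ]≔ inside → w ∈ S [ v ]≔ inside → u ≢ w → Compatible u w
        pairs {u} {w} u∈ w∈ u≢w with ∈-insert⁻ S v u u∈ | ∈-insert⁻ S v w w∈
        ... | inj₁ refl | inj₁ refl = contradiction refl u≢w
        ... | inj₁ refl | inj₂ w∈S  = comp w∈S
        ... | inj₂ u∈S  | inj₁ refl = compatible-sym (comp u∈S)
        ... | inj₂ u∈S  | inj₂ w∈S  = independent⁻ ind u∈S w∈S u≢w

      extends⇒compatible : ∀ {v} → Extends graph S v → ∀ {u} → u ∈ S → Compatible v u
      extends⇒compatible {v} (v∉S , ind′) {u} u∈S =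
        independent⁻ ind′ ([]≔-updates S v) (⊆-insert S v u∈S) λ { refl → v∉S u∈S }

      -- The view of the glued word from a fresh colour agrees with every member, because the glued
      -- word does.
      extension : ∀ i y → ¬ Used i → Extends graph S (vertex i (complete-by y))
      extension i y ¬used = compatible⇒extends comp
        where
        v = vertex i (complete-by y)
        comp : ∀ {u} → u ∈ S → Compatible v u
        comp {u} u∈S =
          (λ eq → ¬used (u , u∈S , trans (sym eq) (colour-vertex i (complete-by y)))) ,
          λ s visv visu → trans
            (value-vertex i (complete-by y) (subst (λ i → Visible i s) (colour-vertex i _) visv))
            (known-value y u∈S visu)

      -- The letter `y` can be read back from the new vertex at the unknown coordinate `s`, so
      -- different letters give different extensions.
      extensions-≥ : ∀ i s → ¬ Used i → Visible i s → ¬ Known s → l ≤ extensions graph S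
      extensions-≥ i s ¬used vis ¬known = injection-size (extends? graph S)
        (λ y → vertex i (complete-by y)) inj (λ y → extension i y ¬used)
        where
        read : ∀ y → value (vertex i (complete-by y)) s ≡ y
        read y = trans (value-vertex i _ vis) (unknown-value y ¬known)
        inj : ∀ {y z} → vertex i (complete-by y) ≡ vertex i (complete-by z) → y ≡ z
        inj {y} {z} eq = trans (sym (read y)) (trans (cong (λ v → value v s) eq) (read z))

      extensions-≡ : Fin l → (∀ i s → ¬ Used i → Visible i s → Known s) →
                     extensions graph S + ∣ S ∣ ≡ q
      extensions-≡ y determined = trans (cong (_+ ∣ S ∣) count-by-colour) unused-count
        where
        E? : ∀ i v → Dec (Extends graph S v × colour v ≡ i)
        E? i v = extends? graph S v ×-dec (colour v ≟ᶠ i)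
        unused-colour : ∀ {v} → Extends graph S v → ¬ Used (colour v)
        unused-colour ext (u , u∈S , eq) = proj₁ (extends⇒compatible ext u∈S) (sym eq)
        unique : ∀ {v w} → Extends graph S v → Extends graph S w → colour v ≡ colour w → v ≡ w
        unique {v} {w} extv extw eq = vertex-≡ eq λ {s} vis →
          let u , u∈S , visu = determined (colour v) s (unused-colour extv) vis
          in trans (proj₂ (extends⇒compatible extv u∈S) s vis visu)
                   (sym (proj₂ (extends⇒compatible extw u∈S) s (subst (λ i → Visible i s) eq vis) visu))
        count-by-colour : extensions graph S ≡ unused
        count-by-colour = begin
          ∑[ v < size ] 𝟙 (extends? graph S v)
            ≡⟨ sum-cong-≗ (λ v → trans
                 (sum-unique (λ i → E? i v) λ (_ , p) (_ , p′) → trans (sym p) p′)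
                 (𝟙-cong (any? λ i → E? i v) (extends? graph S v)
                   (λ (_ , ext , _) → ext) (λ ext → colour v , ext , refl))) ⟨
          ∑[ v < size ] ∑[ i < q ] 𝟙 (E? i v)
            ≡⟨ ∑-comm (λ v i → 𝟙 (E? i v)) ⟩
          ∑[ i < q ] ∑[ v < size ] 𝟙 (E? i v)
            ≡⟨ sum-cong-≗ (λ i → trans
                 (sum-unique (E? i) λ (extv , p) (extw , p′) → unique extv extw (trans p (sym p′)))
                 (𝟙-cong (any? (E? i)) (¬? (used? i))
                   (λ { (v , ext , refl) → unused-colour ext })
                   (λ ¬used → vertex i (complete-by y) , extension i y ¬used , colour-vertex i _))) ⟩
          unused ∎
          where open ≡-Reasoning

  graph-pure : Fin l → Pure q graph
  graph-pure y = record
    { bounded = λ S ind → subst (∣ S ∣ ≤_) (unused-count S ind) (m≤n+m ∣ S ∣ (unused S))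
    ; extend  = λ S ind _ lt →
        let i , ¬used = exists-unused S ind lt in vertex i (complete-by S y) , extension S ind i y ¬used
    }

-- Graphs with many extensions up to size k and forced ones beyond

cover : (g : Fin n → A) (d : A) (S : Subset n) → ∀ {k} → ∣ S ∣ ≤ k →
  Σ (Fin k → A) λ f → (∀ t → f t ≡ d ⊎ ∃ λ v → v ∈ S × f t ≡ g v) × (∀ {v} → v ∈ S → ∃ λ t → f t ≡ g v)
cover g d [] _ = (λ _ → d) , (λ _ → inj₁ refl) , λ ()
cover g d (outside ∷ S) le with f , sound , complete ← cover (g ∘ suc) d S le
  = f , (λ t → map₂ (λ (v , v∈ , eq) → suc v , there v∈ , eq) (sound t)) ,
    λ { (there v∈) → complete v∈ }
cover {A = A} g d (inside ∷ S) {suc k} (s≤s le) with f , sound , complete ← cover (g ∘ suc) d S le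
  = f′ , sound′ , λ { here → zero , refl ; (there v∈) → let t , eq = complete v∈ in suc t , eq }
  where
  f′ : Fin (suc k) → A
  f′ zero    = g zero
  f′ (suc t) = f t
  sound′ : ∀ t → f′ t ≡ d ⊎ ∃ λ v → v ∈ (inside ∷ S) × f′ t ≡ g v
  sound′ zero    = inj₂ (zero , here , refl)
  sound′ (suc t) = map₂ (λ (v , v∈ , eq) → suc v , there v∈ , eq) (sound t)

-- Unlike in `Pure`, the empty set must be extendable too, so that the induction can climb from it,
-- one extension at a time.
pure-positive : {G : Graph n} → (∀ S → Independent G S → ∣ S ∣ < q → ∃ (Extends G S)) →
                ∀ j → j ≤ q → 0 < i j G
pure-positive {n} {G = G} ext zero _ = subst (0 <_) (sym (i-∑ˢ G 0))
  (≤-trans (≤-reflexive (sym (𝟙-yes (indepOfSize? G 0 ⊥) ((λ u v u∈ → contradiction u∈ ∉⊥) , ∣⊥∣≡0 n))))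
           (term≤∑ˢ (λ S → 𝟙 (indepOfSize? G 0 S)) ⊥))
pure-positive {G = G} ext (suc j) j<q = *-cancelˡ-< (suc j) 0 (i (suc j) G) (begin-strict
  suc j * 0            ≡⟨ *-zeroʳ (suc j) ⟩
  0                    <⟨ pure-positive {G = G} ext j (<⇒≤ j<q) ⟩
  i j G                ≡⟨ *-identityʳ _ ⟨
  i j G * 1
    ≤⟨ i-suc-≥ G j 1 (λ S ind sz → positive S (ext S ind (subst (_< _) (sym sz) j<q))) ⟩
  suc j * i (suc j) G  ∎)
  where
  open ≤-Reasoning
  positive : ∀ S → ∃ (Extends G S) → 1 ≤ extensions G S
  positive S (v , e) = ≤-trans (≤-reflexive (sym (𝟙-yes (extends? G S v) e)))
                               (term≤sum (λ v → 𝟙 (extends? G S v)) v)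

-- One-step form of the sequence: `above` is the recurrence satisfied by `(q choose j)`, and `below`
-- forces growth by a factor of at least `l / (j + 1)`.
record Steep (q k l : ℕ) : Set where
  field
    {order}      : ℕ
    steep        : Graph order
    steep-pure   : Pure q steep
    positive     : 0 < i q steep
    above        : ∀ j → k < j → j ≤ q → suc j * i (suc j) steep ≡ i j steep * (q ∸ j)
    below        : ∀ j → 0 < j → j ≤ k → i j steep * l ≤ suc j * i (suc j) steep

-- Coordinates are the k-tuples of colours, and a colour sees the tuples avoiding it.  Any k+1 colours
-- together see everything, while the tuple listing k colours is hidden from all of them.
module TupleGraph (q k l : ℕ) where

  tuple : Fin (q ^ k) → Fin k → Fin q
  tuple = finToFun

  Visible : Fin q → Fin (q ^ k) → Set
  Visible i s = ∀ t → tuple s t ≢ i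

  visible? : ∀ i s → Dec (Visible i s)
  visible? i s = all? λ t → ¬? (tuple s t ≟ᶠ i)

  module _ (V : Vertices q (q ^ k) (suc l) Visible) where
    open Vertices V using (colour)
    open CoordinateGraph visible? V

    -- If no member saw `s`, all their distinct colours would occur among the `k` entries of the
    -- tuple.
    all-known : ∀ S → Independent graph S → k < ∣ S ∣ → ∀ s → Known S s
    all-known S ind k<S s = decidable-stable (known? S s) λ ¬known → <⇒≱ k<S (begin
      ∣ S ∣                                        ≡⟨ used-count S ind ⟨
      ∑[ i < q ] 𝟙 (used? S i)
        ≤⟨ sum-mono (λ i → 𝟙-mono (used? S i) (any? λ t → tuple s t ≟ᶠ i)
             λ { (v , v∈ , refl) → decidable-stable (any? λ t → tuple s t ≟ᶠ _)
                   λ ¬∃ → ¬known (v , v∈ , λ t eq → ¬∃ (t , eq)) }) ⟩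
      ∑[ i < q ] 𝟙 (any? (λ t → tuple s t ≟ᶠ i))   ≤⟨ image-size (tuple s) ⟩
      k                                            ∎)
      where open ≤-Reasoning

    branching : k < q → ∀ S → Independent graph S → 0 < ∣ S ∣ → ∣ S ∣ ≤ k → suc l ≤ extensions graph S
    branching k<q S ind 0<S S≤k
      with w , w∈ ← ∣∣>0⇒Nonempty S 0<S
      with f , sound , complete ← cover colour (colour w) S S≤k
      with i , ¬used ← exists-unused S ind (≤-<-trans S≤k k<q) =
      extensions-≥ S ind i (funToFin f) ¬used visible λ (v , v∈ , vis) →
        let t , eq = complete v∈ in vis t (trans (finToFun-funToFin f t) eq)
      where
      visible : Visible i (funToFin f)
      visible t eq with sound t
      ... | inj₁ p            = ¬used (w , w∈ , trans (sym p) (trans (sym (finToFun-funToFin f t)) eq))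
      ... | inj₂ (v , v∈ , p) = ¬used (v , v∈ , trans (sym p) (trans (sym (finToFun-funToFin f t)) eq))

    graph-steep : k < q → Steep q k (suc l)
    graph-steep k<q = record
      { steep      = graph
      ; steep-pure = graph-pure zero
      ; positive   = pure-positive {G = graph} (λ S ind lt → let i , ¬used = exists-unused S ind lt in
                       _ , extension S ind i zero ¬used) q ≤-refl
      ; above      = λ j k<j j≤q → i-suc-≡ graph j (q ∸ j) λ { S ind refl →
          trans (sym (m+n∸n≡m (extensions graph S) ∣ S ∣))
                (cong (_∸ ∣ S ∣) (extensions-≡ S ind zero λ i s _ _ → all-known S ind k<j s)) }
      ; below      = λ j 0<j j≤k → i-suc-≥ graph j (suc l)
          λ { S ind refl → branching k<q S ind 0<j j≤k }
      }

steepGraph : ∀ q k l → k < q → Steep q k (suc l)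
steepGraph q k l = graph-steep (vertices visible?)
  where open TupleGraph q k l

-- Arranging the independence sequence

joinAll : ∀ {w} → (Fin w → ∃ Graph) → ∃ Graph
joinAll {zero}  Gs = 0 , record { adj = λ () ; symm = λ () ; irrefl = λ () }
joinAll {suc w} Gs = _ , join (proj₂ (Gs zero)) (proj₂ (joinAll (Gs ∘ suc)))

i-joinAll : ∀ {w} (Gs : Fin w → ∃ Graph) j →
            i (suc j) (proj₂ (joinAll Gs)) ≡ ∑[ t < w ] i (suc j) (proj₂ (Gs t))
i-joinAll {zero}  Gs j = refl
i-joinAll {suc w} Gs j =
  trans (i-join (proj₂ (Gs zero)) (proj₂ (joinAll (Gs ∘ suc))) j)
        (cong (i (suc j) (proj₂ (Gs zero)) +_) (i-joinAll (Gs ∘ suc) j))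

joinAll-pure : ∀ {w} (Gs : Fin w → ∃ Graph) → (∀ t → Pure q (proj₂ (Gs t))) →
               Pure q (proj₂ (joinAll Gs))
joinAll-pure {w = zero}  Gs pure = record { bounded = λ { [] _ → z≤n } ; extend = λ { _ _ (() , _) } }
joinAll-pure {w = suc w} Gs pure = join-pure (pure zero) (joinAll-pure (Gs ∘ suc) (pure ∘ suc))

copies : ℕ → Graph n → ∃ Graph
copies a G = joinAll {a} λ _ → _ , G

i-copies : (a : ℕ) (G : Graph n) (j : ℕ) → i (suc j) (proj₂ (copies a G)) ≡ a * i (suc j) G
i-copies a G j = trans (i-joinAll {a} (λ _ → _ , G) j) (sum-const a)
  where
  sum-const : ∀ a → ∑[ t < a ] i (suc j) G ≡ a * i (suc j) G
  sum-const zero    = refl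
  sum-const (suc a) = cong (i (suc j) G +_) (sum-const a)

copies-pure : (a : ℕ) {G : Graph n} → Pure q G → Pure q (proj₂ (copies a G))
copies-pure a pG = joinAll-pure {w = a} _ λ _ → pG

-- From one-step ratios to a single jump

weight : ℕ → ℕ → ℕ
weight q j = j ! * (q ∸ j) !

weight-positive : ∀ q j → 0 < weight q j
weight-positive q j = *-mono-≤ (1≤n! j) (1≤n! (q ∸ j))

-- As weight q j = q! / (q choose j), the quotients i_j / (q choose j) jump from about 0 to E after j = k.
record Jump (q k L E : ℕ) : Set where
  field
    {order} : ℕ
    jump    : Graph order
    pure    : Pure q jump
    above   : ∀ j → k < j → j ≤ q → i j jump * weight q j ≡ E * q !
    below   : ∀ j → 0 < j → j ≤ k → i j jump * L ≤ E

module _ where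
  open +-*-Solver

  peel-complement : ∀ I j d a b → I * (a * (suc d * b)) ≡ (I * suc d) * (a * b)
  peel-complement = solve 5
    (λ I j d a b → I :* (a :* ((con 1 :+ d) :* b)) := (I :* (con 1 :+ d)) :* (a :* b)) refl

  peel-size : ∀ I j a b → (suc j * I) * (a * b) ≡ I * ((suc j * a) * b)
  peel-size = solve 4
    (λ I j a b → ((con 1 :+ j) :* I) :* (a :* b) := I :* (((con 1 :+ j) :* a) :* b)) refl

-- The branching number pays for the step from `k` to `suc k`: the factor `q` bounds `suc k`, the
-- factor `q !` bounds `i (suc k) G` relative to `E = i q G`, and `L` remains as the precision. It
-- is also at least `q`, so the sequence does not decrease from 1 to `k` and the bound at `k` passes
-- down.
steep⇒jump : ∀ q k L → k < q → 0 < L → Steep q k (suc (q * q ! * L)) → ∃ λ E → 0 < E × Jump q k L E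
steep⇒jump q k L k<q 0<L steep-graph = i q G , positive , record
  { jump  = G
  ; pure  = steep-pure
  ; above = λ j k<j j≤q → above′ (q ∸ j) j (m+[n∸m]≡n j≤q) k<j
  ; below = λ j 0<j j≤k → below′ (k ∸ j) j (m+[n∸m]≡n j≤k) 0<j
  }
  where
  l = q * q ! * L
  open Steep steep-graph renaming (steep to G)
  0<q = ≤-<-trans z≤n k<q

  -- By the recurrence, the left side does not change when `j` grows by one; at `j = q` it is the
  -- right side.
  above′ : ∀ d j → j + d ≡ q → k < j → i j G * (j ! * d !) ≡ i q G * q !
  above′ zero    j j+d≡q k<j =
    trans (cong (i j G *_) (*-identityʳ (j !)))
          (cong (λ x → i x G * x !) (trans (sym (+-identityʳ j)) j+d≡q))
  above′ (suc d) j j+d≡q k<j = begin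
    i j G * (j ! * (suc d * d !))              ≡⟨ peel-complement (i j G) j d (j !) (d !) ⟩
    (i j G * suc d) * (j ! * d !)              ≡⟨ cong (λ x → (i j G * x) * (j ! * d !)) q∸j ⟨
    (i j G * (q ∸ j)) * (j ! * d !)            ≡⟨ cong (_* (j ! * d !)) (above j k<j j≤q) ⟨
    (suc j * i (suc j) G) * (j ! * d !)        ≡⟨ peel-size (i (suc j) G) j (j !) (d !) ⟩
    i (suc j) G * (suc j ! * d !)
      ≡⟨ above′ d (suc j) (trans (sym (+-suc j d)) j+d≡q) (m<n⇒m<1+n k<j) ⟩
    i q G * q !                                ∎
    where
    open ≡-Reasoning
    q∸j : q ∸ j ≡ suc d
    q∸j = trans (cong (_∸ j) (sym j+d≡q)) (m+n∸m≡n j (suc d))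
    j≤q : j ≤ q
    j≤q = subst (j ≤_) j+d≡q (m≤m+n j (suc d))

  i-suc-k : i (suc k) G ≤ i q G * q !
  i-suc-k = begin
    i (suc k) G                     ≡⟨ *-identityʳ _ ⟨
    i (suc k) G * 1                 ≤⟨ *-monoʳ-≤ (i (suc k) G) (weight-positive q (suc k)) ⟩
    i (suc k) G * weight q (suc k)  ≡⟨ above′ (q ∸ suc k) (suc k) (m+[n∸m]≡n k<q) ≤-refl ⟩
    i q G * q !                     ∎
    where open ≤-Reasoning

  0<q*q! : 0 < q * q !
  0<q*q! = *-mono-≤ 0<q (1≤n! q)

  below′ : ∀ d j → j + d ≡ k → 0 < j → i j G * L ≤ i q G
  below′ zero j j+d≡k 0<j with refl ← trans (sym (+-identityʳ j)) j+d≡k =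
    *-cancelˡ-≤ (q * q !) {{>-nonZero 0<q*q!}} (begin
      (q * q !) * (i k G * L)
        ≡⟨ solve 3 (λ a I L → a :* (I :* L) := I :* (a :* L)) refl (q * q !) (i k G) L ⟩
      i k G * l                ≤⟨ *-monoʳ-≤ (i k G) (n≤1+n l) ⟩
      i k G * suc l            ≤⟨ below k 0<j ≤-refl ⟩
      suc k * i (suc k) G      ≤⟨ *-mono-≤ k<q i-suc-k ⟩
      q * (i q G * q !)
        ≡⟨ solve 3 (λ a I b → a :* (I :* b) := (a :* b) :* I) refl q (i q G) (q !) ⟩
      (q * q !) * i q G        ∎)
    where
    open ≤-Reasoning
    open +-*-Solver
  below′ (suc d) j j+d≡k 0<j = ≤-trans (*-monoˡ-≤ L i-mono)
    (below′ d (suc j) (trans (sym (+-suc j d)) j+d≡k) (m<n⇒m<1+n 0<j))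
    where
    open ≤-Reasoning
    j<k : j < k
    j<k = subst (j <_) j+d≡k (m<m+n j z<s)
    i-mono : i j G ≤ i (suc j) G
    i-mono = *-cancelˡ-≤ (suc j) (begin
      suc j * i j G        ≡⟨ *-comm (suc j) (i j G) ⟩
      i j G * suc j
        ≤⟨ *-monoʳ-≤ (i j G) (≤-trans j<k (≤-trans (<⇒≤ k<q) (≤-trans q≤l (n≤1+n l)))) ⟩
      i j G * suc l        ≤⟨ below j 0<j (<⇒≤ j<k) ⟩
      suc j * i (suc j) G  ∎)
      where
      q≤l : q ≤ l
      q≤l = begin
        q              ≡⟨ trans (*-identityʳ (q * 1)) (*-identityʳ q) ⟨
        q * 1 * 1      ≤⟨ *-mono-≤ (*-monoʳ-≤ q (1≤n! q)) 0<L ⟩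
        q * q ! * L    ∎

jumpGraph : ∀ q k L → k < q → 0 < L → ∃ λ E → 0 < E × Jump q k L E
jumpGraph q k L k<q 0<L = steep⇒jump q k L k<q 0<L (steepGraph q k (q * q ! * L) k<q)

scale : ∀ {q k L E} (a : ℕ) → Jump q k L E → Jump q k L (a * E)
scale {q} {k} {L} {E} a J = record
  { jump  = proj₂ (copies a jump)
  ; pure  = copies-pure a pure
  ; above = above′
  ; below = below′
  }
  where
  open Jump J
  above′ : ∀ j → k < j → j ≤ q → i j (proj₂ (copies a jump)) * weight q j ≡ a * E * q !
  above′ (suc j) k<j j≤q = begin
    i (suc j) (proj₂ (copies a jump)) * weight q (suc j)
      ≡⟨ cong (_* weight q (suc j)) (i-copies a jump j) ⟩
    a * i (suc j) jump * weight q (suc j)                 ≡⟨ *-assoc a _ _ ⟩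
    a * (i (suc j) jump * weight q (suc j))               ≡⟨ cong (a *_) (above (suc j) k<j j≤q) ⟩
    a * (E * q !)                                         ≡⟨ *-assoc a E (q !) ⟨
    a * E * q !                                           ∎
    where open ≡-Reasoning
  below′ : ∀ j → 0 < j → j ≤ k → i j (proj₂ (copies a jump)) * L ≤ a * E
  below′ (suc j) 0<j j≤k = begin
    i (suc j) (proj₂ (copies a jump)) * L  ≡⟨ cong (_* L) (i-copies a jump j) ⟩
    a * i (suc j) jump * L                 ≡⟨ *-assoc a _ L ⟩
    a * (i (suc j) jump * L)               ≤⟨ *-monoʳ-≤ a (below (suc j) 0<j j≤k) ⟩
    a * E                                  ∎
    where open ≤-Reasoning

-- The common value is the product of all the individual ones: each graph is copied as often as the
-- product of the others.
equalise : ∀ {q L w} (k : Fin w → ℕ) → (∀ t → ∃ λ E → 0 < E × Jump q (k t) L E) →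
           ∃ λ E → 0 < E × (∀ t → Jump q (k t) L E)
equalise {w = zero}  k J = 1 , z<s , λ ()
equalise {q} {L} {suc w} k J
  with E₀ , 0<E₀ , J₀ ← J zero
     | E , 0<E , Js ← equalise (k ∘ suc) (J ∘ suc) =
  E₀ * E , *-mono-≤ 0<E₀ 0<E , λ
    { zero    → subst (Jump q (k zero) L) (*-comm E E₀) (scale E J₀)
    ; (suc t) → scale E₀ (Js t) }

-- Realising a nondecreasing sequence by jumps

-- The argument `p` carries the preceding value; on nondecreasing sequences the truncated
-- subtraction is exact.
differences : ∀ {w} → ℕ → (Fin w → ℕ) → Fin w → ℕ
differences p B zero    = B zero ∸ p
differences p B (suc t) = differences (B zero) (B ∘ suc) t

telescope : ∀ {w} p (B : Fin w → ℕ) → (∀ x → p ≤ B x) → (∀ {x y} → toℕ x < toℕ y → B x ≤ B y) →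
            ∀ x → p + ∑[ t < w ] (𝟙 (toℕ t ≤? toℕ x) * differences p B t) ≡ B x
telescope p B p≤B mono zero = begin
  p + (1 * (B zero ∸ p) + _)
    ≡⟨ cong (λ z → p + (1 * (B zero ∸ p) + z))
         (sum-zero λ t → cong (_* differences (B zero) (B ∘ suc) t) (𝟙-no (suc (toℕ t) ≤? 0) λ ())) ⟩
  p + (1 * (B zero ∸ p) + 0)
    ≡⟨ cong (p +_) (trans (+-identityʳ _) (*-identityˡ _)) ⟩
  p + (B zero ∸ p)
    ≡⟨ m+[n∸m]≡n (p≤B zero) ⟩
  B zero ∎
  where open ≡-Reasoning
telescope {suc w} p B p≤B mono (suc x) = begin
  p + (1 * (B zero ∸ p) + ∑[ t < w ] (𝟙 (suc (toℕ t) ≤? suc (toℕ x)) * differences (B zero) (B ∘ suc) t))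
    ≡⟨ +-assoc p _ _ ⟨
  p + 1 * (B zero ∸ p) + ∑[ t < w ] (𝟙 (suc (toℕ t) ≤? suc (toℕ x)) * differences (B zero) (B ∘ suc) t)
    ≡⟨ cong₂ _+_ (trans (cong (p +_) (*-identityˡ _)) (m+[n∸m]≡n (p≤B zero)))
         (sum-cong-≗ λ t → cong (_* differences (B zero) (B ∘ suc) t)
           (𝟙-cong (suc (toℕ t) ≤? suc (toℕ x)) (toℕ t ≤? toℕ x) s≤s⁻¹ s≤s)) ⟩
  B zero + ∑[ t < w ] (𝟙 (toℕ t ≤? toℕ x) * differences (B zero) (B ∘ suc) t)
    ≡⟨ telescope (B zero) (B ∘ suc) (λ x → mono z<s) (mono ∘ s<s) x ⟩
  B (suc x) ∎
  where open ≡-Reasoning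

-- The quotient of the two weights is `(j + 1) / (q - j)`, which exceeds 1 once `q ≤ 2j`.
weight-suc : ∀ q j → suc j ≤ q → q ≤ j + j → weight q j < weight q (suc j)
weight-suc q j j<q q≤2j with q ∸ suc j in eq
... | d = subst (λ x → j ! * x ! < suc j ! * d !) (sym q∸j) (begin-strict
  j ! * (suc d * d !)
    ≡⟨ solve 3 (λ a b c → a :* (c :* b) := (a :* b) :* c) refl (j !) (d !) (suc d) ⟩
  (j ! * d !) * suc d
    <⟨ *-monoʳ-< (j ! * d !) {{>-nonZero (*-mono-≤ (1≤n! j) (1≤n! d))}} (s<s d<j) ⟩
  (j ! * d !) * suc j
    ≡⟨ solve 3 (λ a b c → (a :* b) :* c := (c :* a) :* b) refl (j !) (d !) (suc j) ⟩
  suc j ! * d !            ∎)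
  where
  open ≤-Reasoning
  open +-*-Solver
  q≡ : suc j + d ≡ q
  q≡ = trans (cong (suc j +_) (sym eq)) (m+[n∸m]≡n j<q)
  q∸j : q ∸ j ≡ suc d
  q∸j = trans (cong (_∸ j) (trans (sym q≡) (sym (+-suc j d)))) (m+n∸m≡n j (suc d))
  d<j : d < j
  d<j = +-cancelˡ-≤ j (suc d) j (≤-trans (≤-reflexive (trans (+-suc j d) q≡)) q≤2j)

weight-step : ∀ {q} c → q ≤ c + c → ∀ y → c + suc y ≤ q → weight q (c + y) < weight q (c + suc y)
weight-step {q} c q≤2c y le rewrite +-suc c y =
  weight-suc q (c + y) le (≤-trans q≤2c (+-mono-≤ (m≤m+n c y) (m≤m+n c y)))

weight-mono : ∀ {q} c → q ≤ c + c → ∀ {x y} → x < y → c + y ≤ q → weight q (c + x) < weight q (c + y)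
weight-mono {q} c q≤2c {x} {suc y} x<1+y c+1+y≤q with m≤n⇒m<n∨m≡n (s≤s⁻¹ x<1+y)
... | inj₁ x<y  = <-trans
  (weight-mono c q≤2c x<y (≤-trans (+-monoʳ-≤ c (n≤1+n y)) c+1+y≤q)) (weight-step c q≤2c y c+1+y≤q)
... | inj₂ refl = weight-step c q≤2c y c+1+y≤q

-- The first prescribed size is `suc c′` because jump `t` takes place after size `c′ + t`: the size
-- at position `x` is past it exactly when `t ≤ x`.
module RollerCoaster (q c′ w : ℕ) (c′+w≡q : c′ + w ≡ q) (q≤2c : q ≤ suc c′ + suc c′)
                     (0<w : 0 < w) (r : Fin w → ℕ) where

  c : ℕ
  c = suc c′

  c+x≤q : (x : Fin w) → c + toℕ x ≤ q
  c+x≤q x = subst (c + toℕ x ≤_) c′+w≡q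
    (subst (_≤ c′ + w) (+-suc c′ (toℕ x)) (+-monoʳ-≤ c′ (toℕ<n x)))

  W : Fin w → ℕ
  W x = weight q (c + toℕ x)

  -- A later position has `W` larger by at least one, which is worth at least `M` in `target`. As
  -- `M` exceeds every `r x * W x`, the ranks cannot spoil monotonicity.
  M : ℕ
  M = suc (sum r * sum W)

  target : Fin w → ℕ
  target x = (M + r x) * W x

  target-mono : ∀ {x y} → toℕ x < toℕ y → target x ≤ target y
  target-mono {x} {y} x<y = begin
    (M + r x) * W x      ≡⟨ *-distribʳ-+ (W x) M (r x) ⟩
    M * W x + r x * W x
      ≤⟨ +-monoʳ-≤ (M * W x) (≤-trans (*-mono-≤ (term≤sum r x) (term≤sum W x)) (n≤1+n _)) ⟩
    M * W x + M          ≡⟨ trans (+-comm (M * W x) M) (sym (*-suc M (W x))) ⟩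
    M * suc (W x)        ≤⟨ *-mono-≤ (m≤m+n M (r y)) (weight-mono c q≤2c x<y (c+x≤q y)) ⟩
    (M + r y) * W y      ∎
    where open ≤-Reasoning

  b : Fin w → ℕ
  b = differences 0 target

  -- Components that have not yet jumped contribute at most `sum b * E / L` in total; this choice
  -- keeps that below `E`, hence below the unit `E * q !`.
  L : ℕ
  L = suc (sum b)

  module Combine (E : ℕ) (0<E : 0 < E) (jumps : ∀ (t : Fin w) → Jump q (c′ + toℕ t) L E) where

    module J (t : Fin w) = Jump (jumps t)

    component : Fin w → ∃ Graph
    component t = copies (b t) (J.jump t)

    G : Graph (proj₁ (joinAll component))
    G = proj₂ (joinAll component)

    G-pure : Pure q G
    G-pure = joinAll-pure component λ t → copies-pure (b t) (J.pure t)

    i-G : ∀ j → i (suc j) G ≡ ∑[ t < w ] (b t * i (suc j) (J.jump t))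
    i-G j = trans (i-joinAll component j) (sum-cong-≗ λ t → i-copies (b t) (J.jump t) j)

    selected : ∀ x → ∑[ t < w ] (𝟙 (toℕ t ≤? toℕ x) * b t) ≡ target x
    selected = telescope 0 target (λ _ → z≤n) target-mono

    module _ (x : Fin w) where
      open +-*-Solver
      open ≤-Reasoning

      I : Fin w → ℕ
      I t = i (c + toℕ x) (J.jump t)

      χ : Fin w → ℕ
      χ t = 𝟙 (toℕ t ≤? toℕ x)

      term-above : ∀ t → toℕ t ≤ toℕ x → I t * W x ≡ E * q !
      term-above t t≤x = J.above t (c + toℕ x) (s≤s (+-monoʳ-≤ c′ t≤x)) (c+x≤q x)

      term-below : ∀ t → ¬ (toℕ t ≤ toℕ x) → I t * L ≤ E
      term-below t t≰x = J.below t (c + toℕ x) z<s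
        (subst (_≤ c′ + toℕ t) (+-suc c′ (toℕ x)) (+-monoʳ-≤ c′ (≰⇒> t≰x)))

      term-lower : ∀ t (d : Dec (toℕ t ≤ toℕ x)) → (𝟙 d * b t) * (E * q !) ≤ (b t * I t) * W x
      term-lower t (no _)    = z≤n
      term-lower t (yes t≤x) = ≤-reflexive (begin-equality
        (1 * b t) * (E * q !)   ≡⟨ cong₂ _*_ (*-identityˡ (b t)) (sym (term-above t t≤x)) ⟩
        b t * (I t * W x)       ≡⟨ *-assoc (b t) (I t) (W x) ⟨
        (b t * I t) * W x       ∎)

      -- The error term is granted to every component, jumped or not, so that the errors add up to a
      -- multiple of `sum b`.
      term-upper : ∀ t (d : Dec (toℕ t ≤ toℕ x)) →
                   (b t * I t) * (W x * L) ≤ (𝟙 d * b t) * (E * q ! * L) + b t * (E * W x)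
      term-upper t (yes t≤x) = begin
        (b t * I t) * (W x * L)
          ≡⟨ solve 4 (λ b I W L → (b :* I) :* (W :* L) := (con 1 :* b) :* ((I :* W) :* L))
               refl (b t) (I t) (W x) L ⟩
        (1 * b t) * ((I t * W x) * L)
          ≡⟨ cong (λ z → (1 * b t) * (z * L)) (term-above t t≤x) ⟩
        (1 * b t) * (E * q ! * L)
          ≤⟨ m≤m+n _ _ ⟩
        (1 * b t) * (E * q ! * L) + b t * (E * W x) ∎
      term-upper t (no t≰x) = begin
        (b t * I t) * (W x * L)
          ≡⟨ solve 4 (λ b I W L → (b :* I) :* (W :* L) := b :* ((I :* L) :* W))
               refl (b t) (I t) (W x) L ⟩
        b t * ((I t * L) * W x)
          ≤⟨ *-monoʳ-≤ (b t) (*-monoˡ-≤ (W x) (term-below t t≰x)) ⟩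
        b t * (E * W x) ∎

      instance
        W-nonZero : NonZero (W x)
        W-nonZero = >-nonZero (weight-positive q (c + toℕ x))

      lower : E * q ! * (M + r x) ≤ i (c + toℕ x) G
      lower = *-cancelʳ-≤ (E * q ! * (M + r x)) (i (c + toℕ x) G) (W x) (begin
        E * q ! * (M + r x) * W x
          ≡⟨ solve 3 (λ a m W → a :* m :* W := (m :* W) :* a) refl (E * q !) (M + r x) (W x) ⟩
        target x * (E * q !)
          ≡⟨ cong (_* (E * q !)) (selected x) ⟨
        ∑[ t < w ] (χ t * b t) * (E * q !)
          ≡⟨ *-distribʳ-sum (E * q !) (λ t → χ t * b t) ⟩
        ∑[ t < w ] ((χ t * b t) * (E * q !))
          ≤⟨ sum-mono (λ t → term-lower t (toℕ t ≤? toℕ x)) ⟩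
        ∑[ t < w ] ((b t * I t) * W x)
          ≡⟨ *-distribʳ-sum (W x) (λ t → b t * I t) ⟨
        ∑[ t < w ] (b t * I t) * W x
          ≡⟨ cong (_* W x) (i-G (c′ + toℕ x)) ⟨
        i (c + toℕ x) G * W x ∎)

      upper : i (c + toℕ x) G < E * q ! * suc (M + r x)
      upper = *-cancelʳ-< (W x * L) (i (c + toℕ x) G) (E * q ! * suc (M + r x)) (begin-strict
        i (c + toℕ x) G * (W x * L)
          ≡⟨ cong (_* (W x * L)) (i-G (c′ + toℕ x)) ⟩
        ∑[ t < w ] (b t * I t) * (W x * L)
          ≡⟨ *-distribʳ-sum (W x * L) (λ t → b t * I t) ⟩
        ∑[ t < w ] ((b t * I t) * (W x * L))
          ≤⟨ sum-mono (λ t → term-upper t (toℕ t ≤? toℕ x)) ⟩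
        ∑[ t < w ] ((χ t * b t) * (E * q ! * L) + b t * (E * W x))
          ≡⟨ ∑-distrib-+ (λ t → (χ t * b t) * (E * q ! * L)) (λ t → b t * (E * W x)) ⟩
        ∑[ t < w ] ((χ t * b t) * (E * q ! * L)) + ∑[ t < w ] (b t * (E * W x))
          ≡⟨ cong₂ _+_ (*-distribʳ-sum (E * q ! * L) (λ t → χ t * b t)) (*-distribʳ-sum (E * W x) b) ⟨
        ∑[ t < w ] (χ t * b t) * (E * q ! * L) + sum b * (E * W x)
          ≡⟨ cong (λ z → z * (E * q ! * L) + sum b * (E * W x)) (selected x) ⟩
        target x * (E * q ! * L) + sum b * (E * W x)
          <⟨ +-monoʳ-< (target x * (E * q ! * L)) (*-monoˡ-< (E * W x)
               {{m*n≢0 E (W x) {{>-nonZero 0<E}}}} (n<1+n (sum b))) ⟩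
        target x * (E * q ! * L) + L * (E * W x)
          ≤⟨ +-monoʳ-≤ (target x * (E * q ! * L)) (*-monoʳ-≤ L (*-monoˡ-≤ (W x) E≤E*q!)) ⟩
        target x * (E * q ! * L) + L * (E * q ! * W x)
          ≡⟨ solve 4 (λ a m W L →
                 (m :* W) :* (a :* L) :+ L :* (a :* W) := (a :* (con 1 :+ m)) :* (W :* L)) refl (E * q !) (M + r x) (W x) L ⟩
        E * q ! * suc (M + r x) * (W x * L) ∎)
        where
        E≤E*q! : E ≤ E * q !
        E≤E*q! = subst (_≤ E * q !) (*-identityʳ E) (*-monoʳ-≤ E (1≤n! q))

    increasing : ∀ x y → r x < r y → i (c + toℕ x) G < i (c + toℕ y) G
    increasing x y rx<ry = <-≤-trans (upper x)
      (≤-trans (*-monoʳ-≤ (E * q !) (subst (_≤ M + r y) (+-suc M (r x)) (+-monoʳ-≤ M rx<ry))) (lower y))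

    -- Size `q` is the last prescribed position, and `lower` is positive there because `M` is a
    -- successor.
    positive : 0 < i q G
    positive = subst (λ j → 0 < i j G) last-index
      (≤-trans (*-mono-≤ (*-mono-≤ 0<E (1≤n! q)) (s≤s z≤n)) (lower last))
      where
      last : Fin w
      last = fromℕ< {pred w} (pred< 0<w)
        where
        pred< : ∀ {w} → 0 < w → pred w < w
        pred< {suc w} _ = ≤-refl
      last-index : c + toℕ last ≡ q
      last-index = trans (cong (c +_) (toℕ-fromℕ< _))
        (trans (sym (+-suc c′ (pred w))) (trans (cong (c′ +_) (suc-pred w {{>-nonZero 0<w}})) c′+w≡q))

  Arranged : Set
  Arranged = ∃ λ n → Σ (Graph n) λ G → Pure q G × 0 < i q G ×
             (∀ x y → r x < r y → i (c + toℕ x) G < i (c + toℕ y) G)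

  combineJumps : (∃ λ E → 0 < E × (∀ (t : Fin w) → Jump q (c′ + toℕ t) L E)) → Arranged
  combineJumps (E , 0<E , jumps) = _ , G , G-pure , positive , increasing
    where open Combine E 0<E jumps

  arranged : Arranged
  arranged = combineJumps
    (equalise (λ t → c′ + toℕ t) λ t → jumpGraph q (c′ + toℕ t) L (c+x≤q t) z<s)

theorem1p7 : (q : ℕ) → .{{_ : NonZero q}} → (σ : Fin (q + 1 ∸ ceilHalf q) ↔ Fin (q + 1 ∸ ceilHalf q)) →
    Σ ℕ λ n → Σ (Graph n) λ G → WellCovered G × IndependenceNumber G q ×
    (∀ (j j′ : Fin (q + 1 ∸ ceilHalf q)) → toℕ j < toℕ j′ →
    i (ceilHalf q + toℕ (Inverse.to σ j)) G < i (ceilHalf q + toℕ (Inverse.to σ j′)) G)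
theorem1p7 q σ = go (ceilHalf q) (m<n⇒0<n∸m q/2<q) (m∸n≤m q (q / 2)) q≤2c σ
  where
  q/2<q : q / 2 < q
  q/2<q = m/n<m q 2 ≤-refl
  q/2≤c : q / 2 ≤ ceilHalf q
  q/2≤c = subst (_≤ ceilHalf q) (m+n∸n≡m (q / 2) (q / 2))
    (∸-monoˡ-≤ (q / 2) (≤-trans (≤-reflexive 2*) (m/n*n≤m q 2)))
    where
    2* : q / 2 + q / 2 ≡ q / 2 * 2
    2* = trans (cong (q / 2 +_) (sym (+-identityʳ (q / 2)))) (*-comm 2 (q / 2))
  q≤2c : q ≤ ceilHalf q + ceilHalf q
  q≤2c = subst (_≤ ceilHalf q + ceilHalf q) (m∸n+n≡m (<⇒≤ q/2<q)) (+-monoʳ-≤ (ceilHalf q) q/2≤c)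
  width : ∀ c′ → q + 1 ∸ suc c′ ≡ q ∸ c′
  width c′ = cong (_∸ suc c′) (+-comm q 1)
  Result : ∀ c → (Fin (q + 1 ∸ c) ↔ Fin (q + 1 ∸ c)) → Set
  Result c σ = Σ ℕ λ n → Σ (Graph n) λ G → WellCovered G × IndependenceNumber G q ×
    (∀ (j j′ : Fin (q + 1 ∸ c)) → toℕ j < toℕ j′ →
      i (c + toℕ (Inverse.to σ j)) G < i (c + toℕ (Inverse.to σ j′)) G)
  -- `ceilHalf q` is abstracted to a variable so that it can be matched as a successor, together
  -- with the type of `σ` that depends on it.
  go : ∀ c → 0 < c → c ≤ q → q ≤ c + c → ∀ σ → Result c σ
  go (suc c′) 0<c c≤q q≤2c σ = finish arranged
    where
    -- The position `σ j` must receive rank `j`, so the ranking is the inverse permutation.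
    open RollerCoaster q c′ (q + 1 ∸ suc c′)
      (trans (cong (c′ +_) (width c′)) (m+[n∸m]≡n (<⇒≤ c≤q))) q≤2c
      (subst (0 <_) (sym (width c′)) (m<n⇒0<n∸m c≤q)) (toℕ ∘ Inverse.from σ)
    0<q : 0 < q
    0<q = ≤-trans 0<c c≤q
    rank : ∀ j → toℕ (Inverse.from σ (Inverse.to σ j)) ≡ toℕ j
    rank j = cong toℕ (Inverse.strictlyInverseʳ σ j)
    finish : Arranged → Result (suc c′) σ
    finish (n , G , pure , positive , increasing) =
      n , G , pure-wellCovered 0<q pure positive , pure-independenceNumber 0<q pure positive ,
      λ j j′ j<j′ → increasing (Inverse.to σ j) (Inverse.to σ j′)
        (subst₂ _<_ (sym (rank j)) (sym (rank j′)) j<j′)
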